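{- Let $k\ge 1$ and $n\ge 1$ be integers, let $S\subseteq\{1,\dots,k\}$ with $d=|S|$, and let $\lambda$ be a partition. If $k\notin S$, the number of large $(k,S)$-Fuss-Schröder paths of length $n$ and type $\lambda$ is \[ \frac{1}{n}\frac{|\lambda|}{kn+1}\binom{dn}{n-|\lambda|}\binom{kn+1}{\ell(\lambda)}\frac{\ell(\lambda)!}{m_\lambda}. \] If $k\in S$, the number of small $(k,S)$-Fuss-Schröder paths of length $n$ and type $\lambda$ is the same quantity \[ \frac{1}{n}\frac{|\lambda|}{kn+1}\binom{dn}{n-|\lambda|}\binom{kn+1}{\ell(\lambda)}\frac{\ell(\lambda)!}{m_\lambda}; \] the number of large $(k,S)$-Fuss-Schröder paths of length $n$ and type $\lambda$ ending in a diagonal step is \[ \frac{1}{n}\binom{dn}{n-1-|\lambda|}\binom{kn}{\ell(\lambda)}\frac{\ell(\lambda)!}{m_\lambda}; \] and the total number of large $(k,S)$-Fuss-Schröder paths of length $n$ and type $\lambda$ is \[ \frac{1}{n} \left(\binom{dn}{n-1-|\lambda|}+\frac{|\lambda|}{kn+1}\binom{dn+1}{n-|\lambda|}\right)\binom{kn+1}{\ell(\lambda)}\frac{\ell(\lambda)!}{m_\lambda}. \]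
   Context: For a partition $\lambda$ (possibly empty), $\ell(\lambda)$ is its number of parts, $|\lambda|$ the sum of its parts, $m_i(\lambda)$ the number of parts equal to $i$, and $m_\lambda=m_1(\lambda)!\,m_2(\lambda)!\,m_3(\lambda)!\cdots$. Binomial coefficients $\binom{a}{b}$ with $b<0$ or $b>a\ge 0$ are $0$. For $S\subseteq\{1,\dots,k\}$, a large $(k,S)$-Fuss-Schröder path of length $n$ is a lattice path from $(0,0)$ to $(n,kn)$ using east steps $(1,0)$, north steps $(0,1)$ and diagonal steps $(1,1)$, which never crosses below the line $y=kx$, and such that each diagonal step goes from the line $y=kj+r-1$ to the line $y=kj+r$ for some integer $j$ and some $r\in S$. It is small if no diagonal step touches the line $y=kx$. The type of such a path is the partition whose parts are the lengths of the maximal runs of consecutive east steps in the path. -}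

module Defs where

open import Data.Fin.Base using (Fin; toℕ)
open import Data.Fin.Subset using (Subset; _∈_)
open import Data.Integer.Base using (ℤ; +_; -[1+_])
open import Data.List.Base using (List; []; _∷_; foldl; last; length; map; filter; upTo)
open import Data.List.Relation.Binary.Permutation.Propositional using (_↭_)
open import Data.List.Relation.Unary.All using (All; universal)
import Data.List.Relation.Unary.All.Properties as All
open import Data.List.Relation.Unary.Linked using (Linked)
open import Data.Maybe.Base using (just)
open import Data.Nat.Base using (ℕ; zero; suc; _+_; _*_; _≤_; _≥_; NonZero; _!)
open import Data.Nat.Combinatorics using (_C_)
open import Data.Nat.ListAction using (sum; product)
open import Data.Nat.ListAction.Properties using (product≢0)
open import Data.Nat.Properties using (_≟_; _!≢0)
open import Data.Product.Base using (∃-syntax; _×_; _,_)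
open import Data.Rational.Base as ℚ using (ℚ)
open import Data.Refinement.Base using (Refinement)
open import Function.Bundles using (_↔_)
open import Relation.Binary.PropositionalEquality using (_≡_)
open import Relation.Nullary using (¬_)

record Partition : Set where
  field
    parts      : List ℕ
    positive   : All (1 ≤_) parts
    decreasing : Linked _≥_ parts

open Partition public

ℓ : Partition → ℕ
ℓ lam = length (parts lam)

size : Partition → ℕ
size lam = sum (parts lam)

mult : ℕ → Partition → ℕ
mult i lam = length (filter (i ≟_) (parts lam))

-- The product ∏_{i ≥ 1} mᵢ(λ)! stops at i = |λ|: no part exceeds |λ|, so
-- all later factors are 0! = 1.
multFactorial : Partition → ℕ
multFactorial lam = product (map (λ i → mult (suc i) lam !) (upTo (size lam)))

multFactorial≢0 : ∀ lam → NonZero (multFactorial lam)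
multFactorial≢0 lam = product≢0
  (All.map⁺ (universal (λ i → mult (suc i) lam !≢0) (upTo (size lam))))

-- ℓ(λ)! / m_λ
arrangements : Partition → ℚ
arrangements lam = + (ℓ lam !) ℚ./ multFactorial lam
  where instance _ = multFactorial≢0 lam

-- _C_ already vanishes when the lower index exceeds the upper one.
binom : ℕ → ℤ → ℕ
binom a (+ b)    = a C b
binom a -[1+ _ ] = 0

fromℕ : ℕ → ℚ
fromℕ a = + a ℚ./ 1

Point : Set
Point = ℕ × ℕ

data Step : Set where
  east north diagonal : Step

Path : Set
Path = List Step

move : Point → Step → Point
move (x , y) east     = suc x , y
move (x , y) north    = x , suc y
move (x , y) diagonal = suc x , suc y

endpoint : Point → Path → Point
endpoint = foldl move

points : Point → Path → List Point
points p []      = p ∷ []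
points p (s ∷ w) = p ∷ points (move p s) w

diagonalStarts : Point → Path → List Point
diagonalStarts p []             = []
diagonalStarts p (east ∷ w)     = diagonalStarts (move p east) w
diagonalStarts p (north ∷ w)    = diagonalStarts (move p north) w
diagonalStarts p (diagonal ∷ w) = p ∷ diagonalStarts (move p diagonal) w

origin : Point
origin = 0 , 0

-- Subset k consists of subsets of {0,…,k-1}; i : Fin k stands for the
-- element i + 1 of {1,…,k}.
infix 4 _∈₁_
_∈₁_ : ∀ {k} → ℕ → Subset k → Set
r ∈₁ S = ∃[ i ] (i ∈ S × suc (toℕ i) ≡ r)

OnLine : ℕ → Point → Set
OnLine k (x , y) = y ≡ k * x

WeaklyAbove : ℕ → Point → Set
WeaklyAbove k (x , y) = k * x ≤ y

-- A diagonal step starting at height y goes from the line y = kj + r - 1 to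
-- the line y = kj + r. Since y ≥ 0 and r ≤ k, the integer j is never negative.
AllowedDiagonal : ∀ {k} → Subset k → Point → Set
AllowedDiagonal {k} S (x , y) =
  ∃[ j ] ∃[ r ] (r ∈₁ S × suc y ≡ k * j + r)

-- Steps are straight segments, so the path stays weakly above y = kx as soon
-- as its lattice points do.
record Large (k : ℕ) (S : Subset k) (n : ℕ) (w : Path) : Set where
  field
    ends      : endpoint origin w ≡ (n , k * n)
    above     : All (WeaklyAbove k) (points origin w)
    diagonals : All (AllowedDiagonal S) (diagonalStarts origin w)

-- A segment weakly above a line meets it in an endpoint if it meets it at all.
TouchingDiagonalFree : ℕ → Path → Set
TouchingDiagonalFree k w =
  All (λ p → ¬ OnLine k p × ¬ OnLine k (move p diagonal)) (diagonalStarts origin w)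

Small : (k : ℕ) → Subset k → ℕ → Path → Set
Small k S n w = Large k S n w × TouchingDiagonalFree k w

EndsInDiagonal : Path → Set
EndsInDiagonal w = last w ≡ just diagonal

closeRun : ℕ → List ℕ → List ℕ
closeRun zero    rs = rs
closeRun (suc c) rs = suc c ∷ rs

-- runsFrom c w lists the lengths of the maximal east runs of w preceded by
-- c east steps.
runsFrom : ℕ → Path → List ℕ
runsFrom c []             = closeRun c []
runsFrom c (east ∷ w)     = runsFrom (suc c) w
runsFrom c (north ∷ w)    = closeRun c (runsFrom 0 w)
runsFrom c (diagonal ∷ w) = closeRun c (runsFrom 0 w)

eastRuns : Path → List ℕ
eastRuns = runsFrom 0

HasType : Partition → Path → Set
HasType lam w = eastRuns w ↭ parts lam

-- Refinement makes the membership proof irrelevant, so that each path is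
-- counted once however many proofs of P it has.
NumberOfPaths : (Path → Set) → ℚ → Set
NumberOfPaths P q = ∃[ N ] ((Refinement Path P ↔ Fin N) × fromℕ N ≡ q)

{-# OPTIONS --safe #-}

-- Complete a path by one north step, at the end (small paths) or at the start
-- (large paths), and cut it into kn + 1 letters, each consisting of a non-east
-- step together with the east run before it (small) or after it (large). In
-- both cases the geometric conditions become: for every j ≥ 1 the lowest j
-- letters contain fewer than j/k units of east displacement. If the top letter
-- has displacement a, the remaining letters form n blocks of k letters over the
-- same alphabets, and by the cycle lemma the proportion a/n of all words
-- satisfies the condition. Summing a over all words separates the choice of the
-- diagonal steps (a binomial coefficient) from the choice of the east runs,
-- where by symmetry each of the kn + 1 runs has average length |λ|/(kn + 1).

module Submission where

module PathCounting where

  open import Defs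
  open import Data.Bool.Base using (Bool; true; false; if_then_else_)
  open import Data.Empty using (⊥-elim)
  open import Data.Fin.Base as Fin using (Fin; toℕ)
  import Data.Fin.Properties as Fin
  open import Data.Fin.Subset using (Subset; ∣_∣) renaming (_∈_ to _∈ˢ_)
  open import Data.Integer.Base as ℤ using ()
  import Data.Integer.Properties as ℤ
  open import Data.Irrelevant using () renaming ([_] to irrelevant)
  open import Data.List.Base hiding (sum; product)
  open import Data.List.Properties hiding (sum-++)
  open import Data.List.Membership.DecPropositional using () renaming (_∈?_ to member?)
  open import Data.List.Membership.Propositional using (_∈_; _∉_)
  open import Data.List.Membership.Propositional.Properties
  open import Data.List.Relation.Binary.Permutation.Propositional
    using (_↭_; prep; swap; ↭-refl; ↭-sym; ↭-trans; ↭-reflexive)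
  open import Data.List.Relation.Binary.Permutation.Propositional.Properties
    using (shift; shifts; drop-∷; ++⁺ˡ; ++-comm; ¬x∷xs↭[]; ∈-resp-↭; All-resp-↭; ↭-length; filter-↭)
    renaming (map⁺ to ↭-map⁺)
  open import Data.List.Relation.Unary.All as All using (All; []; _∷_)
  import Data.List.Relation.Unary.All.Properties as All
  open import Data.List.Relation.Unary.AllPairs using ([]; _∷_)
  open import Data.List.Relation.Unary.Any as Any using (Any; here; there)
  open import Data.List.Relation.Unary.Any.Properties using (lookup-index)
  open import Data.List.Relation.Unary.Unique.Propositional using (Unique)
  import Data.List.Relation.Unary.Unique.Propositional.Properties as Unique
  open import Data.Maybe.Base using (just)
  open import Data.Nat.Base
  open import Data.Nat.Combinatorics using (_C_; nCk+nC[k+1]≡[n+1]C[k+1]; k>n⇒nCk≡0)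
  open import Data.Nat.DivMod using (m≡m%n+[m/n]*n; [m+kn]%n≡m%n; [m+n]%n≡m%n; m<n⇒m%n≡m)
  open import Data.Nat.ListAction using (sum; product)
  open import Data.Nat.ListAction.Properties using (sum-++; sum-↭)
  open import Data.Nat.Properties
  open import Data.Nat.Solver using (module +-*-Solver)
  open import Data.Product.Base using (_×_; _,_; proj₁; proj₂; ∃-syntax)
  open import Data.Refinement.Base using (Refinement; _,_)
  open import Data.Unit.Base using (⊤; tt)
  open import Data.Vec.Base as Vec using ([]; _∷_)
  open import Function.Base using (_∘_; const)
  open import Function.Bundles using (_↔_; mk↔ₛ′)
  open import Relation.Nullary
  open import Relation.Nullary.Decidable using (_×-dec_; map′)
  open import Relation.Binary.PropositionalEquality hiding ([_])

  private variable
    A B X : Set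

  -- Finite sums

  ∑ : List A → (A → ℕ) → ℕ
  ∑ xs f = sum (map f xs)

  ∑-cong : ∀ (xs : List A) {f g : A → ℕ} → (∀ x → f x ≡ g x) → ∑ xs f ≡ ∑ xs g
  ∑-cong xs eq = cong sum (map-cong eq xs)

  ∑-cong-∈ : ∀ (xs : List A) {f g : A → ℕ} → (∀ x → x ∈ xs → f x ≡ g x) → ∑ xs f ≡ ∑ xs g
  ∑-cong-∈ []       eq = refl
  ∑-cong-∈ (x ∷ xs) eq = cong₂ _+_ (eq x (here refl)) (∑-cong-∈ xs (λ y y∈ → eq y (there y∈)))

  ∑-zero : ∀ (xs : List A) → ∑ xs (const 0) ≡ 0
  ∑-zero []       = refl
  ∑-zero (x ∷ xs) = ∑-zero xs

  ∑-+ : ∀ (xs : List A) (f g : A → ℕ) → ∑ xs (λ x → f x + g x) ≡ ∑ xs f + ∑ xs g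
  ∑-+ []       f g = refl
  ∑-+ (x ∷ xs) f g = begin
    (f x + g x) + ∑ xs (λ y → f y + g y)  ≡⟨ cong ((f x + g x) +_) (∑-+ xs f g) ⟩
    (f x + g x) + (∑ xs f + ∑ xs g)       ≡⟨ +-assoc (f x) _ _ ⟩
    f x + (g x + (∑ xs f + ∑ xs g))       ≡⟨ cong (f x +_) (x∙yz≈y∙xz (g x) (∑ xs f) (∑ xs g)) ⟩
    f x + (∑ xs f + (g x + ∑ xs g))       ≡⟨ +-assoc (f x) _ _ ⟨
    (f x + ∑ xs f) + (g x + ∑ xs g)       ∎
    where
    open ≡-Reasoning
    open import Algebra.Properties.CommutativeSemigroup +-commutativeSemigroup using (x∙yz≈y∙xz)

  ∑-*ˡ : ∀ c (xs : List A) (f : A → ℕ) → ∑ xs (λ x → c * f x) ≡ c * ∑ xs f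
  ∑-*ˡ c []       f = sym (*-zeroʳ c)
  ∑-*ˡ c (x ∷ xs) f = trans (cong (c * f x +_) (∑-*ˡ c xs f)) (sym (*-distribˡ-+ c (f x) _))

  ∑-*ʳ : ∀ c (xs : List A) (f : A → ℕ) → ∑ xs (λ x → f x * c) ≡ ∑ xs f * c
  ∑-*ʳ c xs f = trans (∑-cong xs (λ x → *-comm (f x) c)) (trans (∑-*ˡ c xs f) (*-comm c _))

  ∑-swap : ∀ (xs : List A) (ys : List B) (f : A → B → ℕ) →
           ∑ xs (λ x → ∑ ys (f x)) ≡ ∑ ys (λ y → ∑ xs (λ x → f x y))
  ∑-swap []       ys f = sym (∑-zero ys)
  ∑-swap (x ∷ xs) ys f = trans (cong (∑ ys (f x) +_) (∑-swap xs ys f))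
                               (sym (∑-+ ys (f x) (λ y → ∑ xs (λ x′ → f x′ y))))

  ∑-map : ∀ (xs : List A) (g : A → B) (f : B → ℕ) → ∑ (map g xs) f ≡ ∑ xs (f ∘ g)
  ∑-map xs g f = cong sum (sym (map-∘ xs))

  ∑-++ : ∀ (xs ys : List A) (f : A → ℕ) → ∑ (xs ++ ys) f ≡ ∑ xs f + ∑ ys f
  ∑-++ xs ys f = trans (cong sum (map-++ f xs ys)) (sum-++ (map f xs) (map f ys))

  ∑-cartesianProductWith : ∀ (h : A → B → X) xs ys (f : X → ℕ) →
    ∑ (cartesianProductWith h xs ys) f ≡ ∑ xs (λ x → ∑ ys (λ y → f (h x y)))
  ∑-cartesianProductWith h []       ys f = refl
  ∑-cartesianProductWith h (x ∷ xs) ys f = trans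
    (∑-++ (map (h x) ys) (cartesianProductWith h xs ys) f)
    (cong₂ _+_ (∑-map ys (h x) f) (∑-cartesianProductWith h xs ys f))

  ⟦_⟧ : ∀ {P : Set} → Dec P → ℕ
  ⟦ P? ⟧ = if does P? then 1 else 0

  ⟦⟧-yes : ∀ {P : Set} (P? : Dec P) → P → ⟦ P? ⟧ ≡ 1
  ⟦⟧-yes (yes _) p = refl
  ⟦⟧-yes (no ¬p) p = ⊥-elim (¬p p)

  ⟦⟧-no : ∀ {P : Set} (P? : Dec P) → ¬ P → ⟦ P? ⟧ ≡ 0
  ⟦⟧-no (yes p) ¬p = ⊥-elim (¬p p)
  ⟦⟧-no (no _)  ¬p = refl

  ⟦⟧-≢0 : ∀ {P : Set} (P? : Dec P) → ⟦ P? ⟧ ≢ 0 → P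
  ⟦⟧-≢0 (yes p) _  = p
  ⟦⟧-≢0 (no _)  ≢0 = ⊥-elim (≢0 refl)

  ⟦⟧-⇔ : ∀ {P Q : Set} (P? : Dec P) (Q? : Dec Q) → (P → Q) → (Q → P) → ⟦ P? ⟧ ≡ ⟦ Q? ⟧
  ⟦⟧-⇔ P? (yes q) f g = ⟦⟧-yes P? (g q)
  ⟦⟧-⇔ P? (no ¬q) f g = ⟦⟧-no P? (¬q ∘ f)

  ⟦⟧-× : ∀ {P Q : Set} (P? : Dec P) (Q? : Dec Q) → ⟦ P? ×-dec Q? ⟧ ≡ ⟦ P? ⟧ * ⟦ Q? ⟧
  ⟦⟧-× (yes _) (yes _) = refl
  ⟦⟧-× (yes _) (no _)  = refl
  ⟦⟧-× (no _)  (yes _) = refl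
  ⟦⟧-× (no _)  (no _)  = refl

  length-filter-∑ : ∀ {P : A → Set} (P? : ∀ x → Dec (P x)) xs →
                    length (filter P? xs) ≡ ∑ xs (λ x → ⟦ P? x ⟧)
  length-filter-∑ P? []       = refl
  length-filter-∑ P? (x ∷ xs) with P? x
  ... | yes _ = cong suc (length-filter-∑ P? xs)
  ... | no  _ = length-filter-∑ P? xs

  -- Lists with prescribed alphabets

  choices : List (List A) → List (List A)
  choices []       = [ [] ]
  choices (A ∷ As) = cartesianProductWith _∷_ A (choices As)

  ∑-choices-∷ : ∀ (xs : List A) As (f : List A → ℕ) →
    ∑ (choices (xs ∷ As)) f ≡ ∑ xs (λ x → ∑ (choices As) (λ l → f (x ∷ l)))
  ∑-choices-∷ xs As f = ∑-cartesianProductWith _∷_ xs (choices As) f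

  ∑-choices-++ : ∀ (As Bs : List (List A)) (f : List A → ℕ) →
    ∑ (choices (As ++ Bs)) f ≡ ∑ (choices As) (λ u → ∑ (choices Bs) (λ v → f (u ++ v)))
  ∑-choices-++ []       Bs f = sym (+-identityʳ _)
  ∑-choices-++ (xs ∷ As) Bs f = begin
    ∑ (choices (xs ∷ As ++ Bs)) f
      ≡⟨ ∑-choices-∷ xs (As ++ Bs) f ⟩
    ∑ xs (λ x → ∑ (choices (As ++ Bs)) (λ l → f (x ∷ l)))
      ≡⟨ ∑-cong xs (λ x → ∑-choices-++ As Bs (λ l → f (x ∷ l))) ⟩
    ∑ xs (λ x → ∑ (choices As) (λ u → ∑ (choices Bs) (λ v → f (x ∷ u ++ v))))
      ≡⟨ ∑-choices-∷ xs As _ ⟨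
    ∑ (choices (xs ∷ As)) (λ u → ∑ (choices Bs) (λ v → f (u ++ v))) ∎
    where open ≡-Reasoning

  length-choices : ∀ (As : List (List A)) {l} → l ∈ choices As → length l ≡ length As
  length-choices []        (here refl) = refl
  length-choices (xs ∷ As) l∈
    with _ , _ , _ , v∈ , refl ← ∈-cartesianProductWith⁻ _∷_ xs (choices As) l∈
    = cong suc (length-choices As v∈)

  -- The cycle lemma

  pow : ℕ → List A → List A
  pow zero    as = []
  pow (suc n) as = as ++ pow n as

  length-pow : ∀ n (as : List A) → length (pow n as) ≡ n * length as
  length-pow zero    as = refl
  length-pow (suc n) as = trans (length-++ as) (cong (length as +_) (length-pow n as))

  Symmetric : (List A → ℕ) → Set
  Symmetric f = ∀ {u v} → u ↭ v → f u ≡ f v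

  Symmetric-prefix : ∀ {f : List A → ℕ} → Symmetric f → ∀ u → Symmetric (λ v → f (u ++ v))
  Symmetric-prefix sym-f u v↭v′ = sym-f (++⁺ˡ u v↭v′)

  module Weighted {A : Set} (wt : A → ℕ) where

    W : List A → ℕ
    W l = ∑ l wt

    W-++ : ∀ u v → W (u ++ v) ≡ W u + W v
    W-++ u v = ∑-++ u v wt

    first-block-sum : ∀ block n {ψ} → Symmetric ψ →
      ∑ (choices (pow (suc n) block)) (λ l → W l * ψ l) ≡
      suc n * ∑ (choices block) (λ u → ∑ (choices (pow n block)) (λ v → W u * ψ (u ++ v)))
    first-block-sum block n {ψ} sym-ψ = begin
      ∑ (choices (pow (suc n) block)) (λ l → W l * ψ l)
        ≡⟨ ∑-choices-++ block (pow n block) _ ⟩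
      ∑ (choices block) (λ u → ∑ (choices (pow n block)) (λ v → W (u ++ v) * ψ (u ++ v)))
        ≡⟨ ∑-cong (choices block) (λ u → ∑-cong (choices (pow n block)) (λ v →
             trans (cong (_* ψ (u ++ v)) (W-++ u v)) (*-distribʳ-+ (ψ (u ++ v)) (W u) (W v)))) ⟩
      ∑ (choices block) (λ u → ∑ (choices (pow n block)) (λ v → W u * ψ (u ++ v) + W v * ψ (u ++ v)))
        ≡⟨ ∑-cong (choices block) (λ u → ∑-+ (choices (pow n block)) _ _) ⟩
      ∑ (choices block) (λ u → ∑ (choices (pow n block)) (λ v → W u * ψ (u ++ v))
                             + ∑ (choices (pow n block)) (λ v → W v * ψ (u ++ v)))
        ≡⟨ ∑-+ (choices block) _ _ ⟩
      first + ∑ (choices block) (λ u → ∑ (choices (pow n block)) (λ v → W v * ψ (u ++ v)))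
        ≡⟨ cong (first +_) (later n refl) ⟩
      first + n * first ∎
      where
      open ≡-Reasoning
      first : ℕ
      first = ∑ (choices block) (λ u → ∑ (choices (pow n block)) (λ v → W u * ψ (u ++ v)))
      later : ∀ m → m ≡ n →
        ∑ (choices block) (λ u → ∑ (choices (pow m block)) (λ v → W v * ψ (u ++ v))) ≡
        m * ∑ (choices block) (λ u → ∑ (choices (pow m block)) (λ v → W u * ψ (u ++ v)))
      later zero    _ = ∑-zero (choices block)
      later (suc m) refl = begin
        ∑ (choices block) (λ u → ∑ (choices (pow (suc m) block)) (λ v → W v * ψ (u ++ v)))
          ≡⟨ ∑-cong (choices block) (λ u → first-block-sum block m (Symmetric-prefix sym-ψ u)) ⟩
        ∑ (choices block) (λ u → suc m *
          ∑ (choices block) (λ u′ → ∑ (choices (pow m block)) (λ v → W u′ * ψ (u ++ u′ ++ v))))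
          ≡⟨ ∑-*ˡ (suc m) (choices block) _ ⟩
        suc m * ∑ (choices block) (λ u →
          ∑ (choices block) (λ u′ → ∑ (choices (pow m block)) (λ v → W u′ * ψ (u ++ u′ ++ v))))
          ≡⟨ cong (suc m *_) (∑-swap (choices block) (choices block) _) ⟩
        suc m * ∑ (choices block) (λ u′ →
          ∑ (choices block) (λ u → ∑ (choices (pow m block)) (λ v → W u′ * ψ (u ++ u′ ++ v))))
          ≡⟨ cong (suc m *_) (∑-cong (choices block) (λ u′ → ∑-cong (choices block) (λ u →
               ∑-cong (choices (pow m block)) (λ v → cong (W u′ *_) (sym-ψ (shifts u u′)))))) ⟩
        suc m * ∑ (choices block) (λ u′ →
          ∑ (choices block) (λ u → ∑ (choices (pow m block)) (λ v → W u′ * ψ (u′ ++ u ++ v))))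
          ≡⟨ cong (suc m *_) (∑-cong (choices block) (λ u′ → sym (∑-choices-++ block (pow m block) _))) ⟩
        suc m * ∑ (choices block) (λ u′ → ∑ (choices (pow (suc m) block)) (λ v → W u′ * ψ (u′ ++ v))) ∎

    module _ (k : ℕ) where

      Below : List A → Set
      Below []      = ⊤
      Below (x ∷ l) = k * W (x ∷ l) < suc (length l) × Below l

      below? : ∀ l → Dec (Below l)
      below? []      = yes tt
      below? (x ∷ l) = (k * W (x ∷ l) <? suc (length l)) ×-dec below? l

      Below-++⁻ : ∀ u {v} → Below (u ++ v) → Below v
      Below-++⁻ []      p       = p
      Below-++⁻ (_ ∷ u) (_ , p) = Below-++⁻ u p

      Below-++⁺ : ∀ u {v} → k * W (u ++ v) ≤ length v → Below v → Below (u ++ v)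
      Below-++⁺ []      _  p = p
      Below-++⁺ (x ∷ u) {v} le p =
        s≤s (≤-trans le (≤-trans (m≤n+m _ (length u)) (≤-reflexive (sym (length-++ u))))) ,
        Below-++⁺ u (≤-trans (*-monoʳ-≤ k (m≤n+m (W (u ++ v)) (wt x))) le) p

      module _ (block : List (List A)) (length-block : length block ≡ k) .{{_ : NonZero k}} where

        length-choices-pow : ∀ n {l} → l ∈ choices (pow n block) → length l ≡ n * k
        length-choices-pow n l∈ = trans (length-choices (pow n block) l∈)
          (trans (length-pow n block) (cong (n *_) length-block))

        ¬Below-full : ∀ n l → length l ≡ suc n * k → W l ≡ suc n → ¬ Below l
        ¬Below-full n []      eq _  _       = ≢-nonZero⁻¹ k (m+n≡0⇒m≡0 k (sym eq))
        ¬Below-full n (x ∷ l) eq eW (p , _) =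
          <-irrefl (trans (cong (k *_) eW) (trans (*-comm k (suc n)) (sym eq))) p

        -- Conditioning on the first block u replaces a by W u + a - 1, and by
        -- symmetry W u has average (n - a) / n.
        cycle-lemma : ∀ n a {ψ} → Symmetric ψ → (∀ l → ψ l ≢ 0 → W l + a ≡ n) →
          n * ∑ (choices (pow n block)) (λ l → ⟦ below? l ⟧ * ψ l) ≡
          a * ∑ (choices (pow n block)) ψ
        cycle-lemma zero a {ψ} _ supp = sym (helper (ψ [] ≟ 0))
          where
          helper : Dec (ψ [] ≡ 0) → a * (ψ [] + 0) ≡ 0
          helper (yes eq) = trans (cong (λ z → a * (z + 0)) eq) (*-zeroʳ a)
          helper (no neq) rewrite supp [] neq = refl
        cycle-lemma (suc n) zero {ψ} _ supp = begin
          suc n * ∑ (choices (pow (suc n) block)) (λ l → ⟦ below? l ⟧ * ψ l)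
            ≡⟨ cong (suc n *_) (∑-cong-∈ (choices (pow (suc n) block)) vanish) ⟩
          suc n * ∑ (choices (pow (suc n) block)) (const 0)
            ≡⟨ cong (suc n *_) (∑-zero (choices (pow (suc n) block))) ⟩
          suc n * 0
            ≡⟨ *-zeroʳ (suc n) ⟩
          0 ∎
          where
          open ≡-Reasoning
          vanish : ∀ l → l ∈ choices (pow (suc n) block) → ⟦ below? l ⟧ * ψ l ≡ 0
          vanish l l∈ with ψ l ≟ 0
          ... | yes eq = trans (cong (⟦ below? l ⟧ *_) eq) (*-zeroʳ ⟦ below? l ⟧)
          ... | no neq = cong (_* ψ l) (⟦⟧-no (below? l) (¬Below-full n l
                  (length-choices-pow (suc n) l∈) (trans (sym (+-identityʳ _)) (supp l neq))))
        cycle-lemma (suc n) (suc a) {ψ} sym-ψ supp = trans (cong (suc n *_) G≡G′) (combine n refl)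
          where
          open ≡-Reasoning
          rest : List A → ℕ
          rest u = ∑ (choices (pow n block)) (λ v → ψ (u ++ v))

          G G′ T V : ℕ
          G = ∑ (choices (pow (suc n) block)) (λ l → ⟦ below? l ⟧ * ψ l)
          G′ = ∑ (choices block) (λ u → ∑ (choices (pow n block)) (λ v → ⟦ below? v ⟧ * ψ (u ++ v)))
          T = ∑ (choices (pow (suc n) block)) ψ
          V = ∑ (choices block) (λ u → W u * rest u)

          drop-block : ∀ u v → v ∈ choices (pow n block) →
                       ⟦ below? (u ++ v) ⟧ * ψ (u ++ v) ≡ ⟦ below? v ⟧ * ψ (u ++ v)
          drop-block u v v∈ with ψ (u ++ v) ≟ 0
          ... | yes eq rewrite eq = trans (*-zeroʳ ⟦ below? (u ++ v) ⟧) (sym (*-zeroʳ ⟦ below? v ⟧))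
          ... | no neq = cong (_* ψ (u ++ v)) (⟦⟧-⇔ (below? (u ++ v)) (below? v)
                  (Below-++⁻ u) (Below-++⁺ u bound))
            where
            W≤n : W (u ++ v) ≤ n
            W≤n = s≤s⁻¹ (≤-trans (s≤s (m≤m+n _ a)) (≤-reflexive
                    (trans (sym (+-suc _ a)) (supp (u ++ v) neq))))
            bound : k * W (u ++ v) ≤ length v
            bound = ≤-trans (*-monoʳ-≤ k W≤n)
              (≤-reflexive (trans (*-comm k n) (sym (length-choices-pow n v∈))))

          G≡G′ : G ≡ G′
          G≡G′ = trans (∑-choices-++ block (pow n block) _)
            (∑-cong (choices block) (λ u → ∑-cong-∈ (choices (pow n block)) (drop-block u)))

          T≡∑rest : T ≡ ∑ (choices block) rest
          T≡∑rest = ∑-choices-++ block (pow n block) ψ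

          step : n * G′ ≡ V + a * T
          step = begin
            n * G′
              ≡⟨ ∑-*ˡ n (choices block) _ ⟨
            ∑ (choices block) (λ u → n * ∑ (choices (pow n block)) (λ v → ⟦ below? v ⟧ * ψ (u ++ v)))
              ≡⟨ ∑-cong (choices block) (λ u →
                   cycle-lemma n (W u + a) (Symmetric-prefix sym-ψ u) (supp-prefix u)) ⟩
            ∑ (choices block) (λ u → (W u + a) * rest u)
              ≡⟨ ∑-cong (choices block) (λ u → *-distribʳ-+ (rest u) (W u) a) ⟩
            ∑ (choices block) (λ u → W u * rest u + a * rest u)
              ≡⟨ ∑-+ (choices block) _ _ ⟩
            V + ∑ (choices block) (λ u → a * rest u)
              ≡⟨ cong (V +_) (∑-*ˡ a (choices block) rest) ⟩
            V + a * ∑ (choices block) rest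
              ≡⟨ cong (λ z → V + a * z) T≡∑rest ⟨
            V + a * T ∎
            where
            supp-prefix : ∀ u v → ψ (u ++ v) ≢ 0 → W v + (W u + a) ≡ n
            supp-prefix u v neq = suc-injective (begin
              suc (W v + (W u + a))   ≡⟨ cong suc (trans (sym (+-assoc (W v) (W u) a))
                                                         (cong (_+ a) (+-comm (W v) (W u)))) ⟩
              suc (W u + W v + a)     ≡⟨ cong (λ z → suc (z + a)) (W-++ u v) ⟨
              suc (W (u ++ v) + a)    ≡⟨ +-suc _ a ⟨
              W (u ++ v) + suc a      ≡⟨ supp (u ++ v) neq ⟩
              suc n                   ∎)

          balance : suc n * V + a * T ≡ n * T
          balance = begin
            suc n * V + a * T
              ≡⟨ cong (_+ a * T) (cong (suc n *_) (∑-cong (choices block)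
                   (λ u → sym (∑-*ˡ (W u) (choices (pow n block)) _)))) ⟩
            suc n * ∑ (choices block) (λ u → ∑ (choices (pow n block)) (λ v → W u * ψ (u ++ v))) + a * T
              ≡⟨ cong₂ _+_ (first-block-sum block n sym-ψ) (∑-*ˡ a (choices (pow (suc n) block)) ψ) ⟨
            ∑ (choices (pow (suc n) block)) (λ l → W l * ψ l) + ∑ (choices (pow (suc n) block)) (λ l → a * ψ l)
              ≡⟨ ∑-+ (choices (pow (suc n) block)) _ _ ⟨
            ∑ (choices (pow (suc n) block)) (λ l → W l * ψ l + a * ψ l)
              ≡⟨ ∑-cong (choices (pow (suc n) block)) pointwise ⟩
            ∑ (choices (pow (suc n) block)) (λ l → n * ψ l)
              ≡⟨ ∑-*ˡ n (choices (pow (suc n) block)) ψ ⟩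
            n * T ∎
            where
            pointwise : ∀ l → W l * ψ l + a * ψ l ≡ n * ψ l
            pointwise l with ψ l ≟ 0
            ... | yes eq rewrite eq =
              trans (cong₂ _+_ (*-zeroʳ (W l)) (*-zeroʳ a)) (sym (*-zeroʳ n))
            ... | no neq = trans (sym (*-distribʳ-+ (ψ l) (W l) a))
              (cong (_* ψ l) (suc-injective (trans (sym (+-suc (W l) a)) (supp l neq))))

          combine : ∀ m → m ≡ n → suc m * G′ ≡ suc a * T
          combine zero refl = begin
            G′ + 0     ≡⟨ +-identityʳ G′ ⟩
            G′         ≡⟨ ∑-cong (choices block) (λ u → cong (_+ 0) (+-identityʳ (ψ (u ++ [])))) ⟩
            ∑ (choices block) rest ≡⟨ T≡∑rest ⟨
            T          ≡⟨ +-identityʳ T ⟨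
            T + 0      ≡⟨ cong (T +_) (m+n≡0⇒n≡0 (1 * V) balance) ⟨
            T + a * T  ∎
          combine (suc m) refl = *-cancelˡ-≡ _ _ n (begin
            n * (suc n * G′)           ≡⟨ solve 2 (λ n g → n :* ((con 1 :+ n) :* g) := (con 1 :+ n) :* (n :* g)) refl n G′ ⟩
            suc n * (n * G′)           ≡⟨ cong (suc n *_) step ⟩
            suc n * (V + a * T)        ≡⟨ solve 4 (λ n v a t → (con 1 :+ n) :* (v :+ a :* t)
                                            := ((con 1 :+ n) :* v :+ a :* t) :+ n :* (a :* t)) refl n V a T ⟩
            suc n * V + a * T + n * (a * T) ≡⟨ cong (_+ n * (a * T)) balance ⟩
            n * T + n * (a * T)        ≡⟨ *-distribˡ-+ n T (a * T) ⟨
            n * (suc a * T)            ∎)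
            where open +-*-Solver

  -- Diagonals

  bit : Bool → ℕ
  bit b = if b then 1 else 0

  steps : Bool → List Bool
  steps true  = false ∷ true ∷ []
  steps false = false ∷ []

  ∑-steps : ∀ bs j → ∑ (choices (map steps bs)) (λ ds → ⟦ ∑ ds bit ≟ j ⟧) ≡ ∑ bs bit C j
  ∑-steps []           zero    = refl
  ∑-steps []           (suc j) = sym (k>n⇒nCk≡0 {0} {suc j} (s≤s z≤n))
  ∑-steps (false ∷ bs) j       = begin
    ∑ (choices (map steps (false ∷ bs))) (λ ds → ⟦ ∑ ds bit ≟ j ⟧)
      ≡⟨ ∑-choices-∷ (false ∷ []) (map steps bs) _ ⟩
    ∑ (choices (map steps bs)) (λ ds → ⟦ ∑ ds bit ≟ j ⟧) + 0
      ≡⟨ +-identityʳ _ ⟩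
    ∑ (choices (map steps bs)) (λ ds → ⟦ ∑ ds bit ≟ j ⟧)
      ≡⟨ ∑-steps bs j ⟩
    ∑ bs bit C j ∎
    where open ≡-Reasoning
  ∑-steps (true ∷ bs)  j       = trans (∑-choices-∷ (false ∷ true ∷ []) (map steps bs) _) (pascal j)
    where
    open ≡-Reasoning
    pascal : ∀ j → ∑ (choices (map steps bs)) (λ ds → ⟦ ∑ ds bit ≟ j ⟧)
               + (∑ (choices (map steps bs)) (λ ds → ⟦ suc (∑ ds bit) ≟ j ⟧) + 0)
               ≡ suc (∑ bs bit) C j
    pascal zero = begin
      ∑ (choices (map steps bs)) (λ ds → ⟦ ∑ ds bit ≟ 0 ⟧)
        + (∑ (choices (map steps bs)) (λ ds → ⟦ suc (∑ ds bit) ≟ 0 ⟧) + 0)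
        ≡⟨ cong₂ _+_ (∑-steps bs 0) (trans (+-identityʳ _) (∑-zero (choices (map steps bs)))) ⟩
      ∑ bs bit C 0 + 0 ≡⟨⟩
      1 ∎
    pascal (suc j) = begin
      ∑ (choices (map steps bs)) (λ ds → ⟦ ∑ ds bit ≟ suc j ⟧)
        + (∑ (choices (map steps bs)) (λ ds → ⟦ suc (∑ ds bit) ≟ suc j ⟧) + 0)
        ≡⟨ cong₂ _+_ (∑-steps bs (suc j)) (trans (+-identityʳ _)
             (trans (∑-cong (choices (map steps bs)) (λ ds →
                      ⟦⟧-⇔ (suc (∑ ds bit) ≟ suc j) (∑ ds bit ≟ j) suc-injective (cong suc)))
                    (∑-steps bs j))) ⟩
      ∑ bs bit C suc j + ∑ bs bit C j    ≡⟨ +-comm (∑ bs bit C suc j) _ ⟩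
      ∑ bs bit C j + ∑ bs bit C suc j    ≡⟨ nCk+nC[k+1]≡[n+1]C[k+1] (∑ bs bit) j ⟩
      suc (∑ bs bit) C suc j             ∎

  ∑-steps-binom : ∀ bs n c →
    ∑ (choices (map steps bs)) (λ ds → ⟦ ∑ ds bit + c ≟ n ⟧) ≡ binom (∑ bs bit) (ℤ.+ n ℤ.- ℤ.+ c)
  ∑-steps-binom bs n c with c ≤? n
  ... | yes c≤n = begin
    ∑ (choices (map steps bs)) (λ ds → ⟦ ∑ ds bit + c ≟ n ⟧)
      ≡⟨ ∑-cong (choices (map steps bs)) (λ ds → ⟦⟧-⇔ (∑ ds bit + c ≟ n) (∑ ds bit ≟ n ∸ c)
           (λ eq → trans (sym (m+n∸n≡m (∑ ds bit) c)) (cong (_∸ c) eq))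
           (λ eq → trans (cong (_+ c) eq) (m∸n+n≡m c≤n))) ⟩
    ∑ (choices (map steps bs)) (λ ds → ⟦ ∑ ds bit ≟ n ∸ c ⟧)
      ≡⟨ ∑-steps bs (n ∸ c) ⟩
    binom (∑ bs bit) (ℤ.+ (n ∸ c))
      ≡⟨ cong (binom (∑ bs bit)) (trans (ℤ.m-n≡m⊖n n c) (ℤ.⊖-≥ c≤n)) ⟨
    binom (∑ bs bit) (ℤ.+ n ℤ.- ℤ.+ c) ∎
    where open ≡-Reasoning
  ... | no c≰n = begin
    ∑ (choices (map steps bs)) (λ ds → ⟦ ∑ ds bit + c ≟ n ⟧)
      ≡⟨ ∑-cong (choices (map steps bs)) (λ ds → ⟦⟧-no (∑ ds bit + c ≟ n)
           (λ eq → c≰n (≤-trans (m≤n+m c (∑ ds bit)) (≤-reflexive eq)))) ⟩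
    ∑ (choices (map steps bs)) (const 0)
      ≡⟨ ∑-zero (choices (map steps bs)) ⟩
    0
      ≡⟨ cong (binom (∑ bs bit)) (trans (ℤ.m-n≡m⊖n n c) (trans (ℤ.⊖-< c>n) (cong (λ z → ℤ.- ℤ.+ z) (suc[m∸n] c>n)))) ⟨
    binom (∑ bs bit) (ℤ.+ n ℤ.- ℤ.+ c) ∎
    where
    open ≡-Reasoning
    c>n : n < c
    c>n = ≰⇒> c≰n
    suc[m∸n] : ∀ {m n} → n < m → m ∸ n ≡ suc (m ∸ suc n)
    suc[m∸n] {suc m} {n} (s≤s n≤m) = +-∸-assoc 1 n≤m

  -- Rearrangements of a multiset

  nonzeros : List ℕ → List ℕ
  nonzeros = foldr closeRun []

  closeRun-↭ : ∀ e {xs ys} → xs ↭ ys → closeRun e xs ↭ closeRun e ys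
  closeRun-↭ zero    p = p
  closeRun-↭ (suc e) p = prep _ p

  closeRun-swap : ∀ e e′ {xs} → closeRun e (closeRun e′ xs) ↭ closeRun e′ (closeRun e xs)
  closeRun-swap zero    e′       = ↭-refl
  closeRun-swap (suc e) zero     = ↭-refl
  closeRun-swap (suc e) (suc e′) = swap _ _ ↭-refl

  nonzeros-↭ : ∀ {es es′} → es ↭ es′ → nonzeros es ↭ nonzeros es′
  nonzeros-↭ _↭_.refl         = ↭-refl
  nonzeros-↭ (prep e p)   = closeRun-↭ e (nonzeros-↭ p)
  nonzeros-↭ (swap e e′ p) = ↭-trans (closeRun-↭ e (closeRun-↭ e′ (nonzeros-↭ p))) (closeRun-swap e e′)
  nonzeros-↭ (_↭_.trans p q)  = ↭-trans (nonzeros-↭ p) (nonzeros-↭ q)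

  sum-closeRun : ∀ e es → sum (closeRun e es) ≡ e + sum es
  sum-closeRun zero    es = refl
  sum-closeRun (suc e) es = refl

  sum-nonzeros : ∀ es → sum (nonzeros es) ≡ sum es
  sum-nonzeros []       = refl
  sum-nonzeros (e ∷ es) = trans (sum-closeRun e (nonzeros es)) (cong (λ z → e + z) (sum-nonzeros es))

  infix 4 _∈?_ _↭?_

  _∈?_ : ∀ (x : ℕ) xs → Dec (x ∈ xs)
  _∈?_ = member? _≟_

  _↭?_ : ∀ (xs ys : List ℕ) → Dec (xs ↭ ys)
  []     ↭? []     = yes ↭-refl
  []     ↭? y ∷ ys = no (¬x∷xs↭[] ∘ ↭-sym)
  x ∷ xs ↭? ys with x ∈? ys
  ... | no  x∉ = no (λ p → x∉ (∈-resp-↭ p (here refl)))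
  ... | yes x∈ with as , bs , refl ← ∈-∃++ x∈ =
    map′ (λ p → ↭-trans (prep x p) (↭-sym (shift x as bs)))
         (λ p → drop-∷ (↭-trans p (shift x as bs)))
         (xs ↭? as ++ bs)

  ⟦↭⟧-cong : ∀ {xs xs′ ys ys′} → xs ↭ xs′ → ys ↭ ys′ → ⟦ xs ↭? ys ⟧ ≡ ⟦ xs′ ↭? ys′ ⟧
  ⟦↭⟧-cong {xs} {xs′} {ys} {ys′} p q = ⟦⟧-⇔ (xs ↭? ys) (xs′ ↭? ys′)
    (λ r → ↭-trans (↭-sym p) (↭-trans r q)) (λ r → ↭-trans p (↭-trans r (↭-sym q)))

  count : ℕ → List ℕ → ℕ
  count v xs = length (filter (v ≟_) xs)

  count-∷ : ∀ v x xs → count v (x ∷ xs) ≡ ⟦ v ≟ x ⟧ + count v xs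
  count-∷ v x xs with does (v ≟ x)
  ... | true  = refl
  ... | false = refl

  count-∉ : ∀ v xs → v ∉ xs → count v xs ≡ 0
  count-∉ v []       _  = refl
  count-∉ v (x ∷ xs) v∉ = trans (count-∷ v x xs)
    (cong₂ _+_ (⟦⟧-no (v ≟ x) (v∉ ∘ here)) (count-∉ v xs (v∉ ∘ there)))

  ∑-single : ∀ {xs j} → Unique xs → j ∈ xs → ∑ xs (λ i → ⟦ i ≟ j ⟧) ≡ 1
  ∑-single {x ∷ xs} {j} (x∉ ∷ _) (here refl) = cong₂ _+_ (⟦⟧-yes (j ≟ j) refl)
    (trans (∑-cong-∈ xs (λ y y∈ → ⟦⟧-no (y ≟ j) (λ eq → All.lookup x∉ y∈ (sym eq)))) (∑-zero xs))
  ∑-single {x ∷ xs} {j} (x∉ ∷ u) (there j∈) =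
    cong₂ _+_ (⟦⟧-no (x ≟ j) (All.lookup x∉ j∈)) (∑-single u j∈)

  product-scale : ∀ {xs} {j} c {f g : ℕ → ℕ} → Unique xs → j ∈ xs → f j ≡ c * g j →
    (∀ i → i ≢ j → f i ≡ g i) → product (map f xs) ≡ c * product (map g xs)
  product-scale {x ∷ xs} c {f} {g} (x∉ ∷ _) (here refl) eq eqs = trans
    (cong₂ _*_ eq (cong product (away xs (All.map (λ ne eq′ → ne (sym eq′)) x∉))))
    (*-assoc c (g x) _)
    where
    away : ∀ ys → All (_≢ x) ys → map f ys ≡ map g ys
    away []       []         = refl
    away (y ∷ ys) (ne ∷ nes) = cong₂ _∷_ (eqs y ne) (away ys nes)
  product-scale {x ∷ xs} c {f} {g} (x∉ ∷ u) (there j∈) eq eqs = begin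
    f x * product (map f xs)        ≡⟨ cong₂ _*_ (eqs x (All.lookup x∉ j∈)) (product-scale c u j∈ eq eqs) ⟩
    g x * (c * product (map g xs))  ≡⟨ solve 3 (λ a b d → a :* (b :* d) := b :* (a :* d)) refl (g x) c _ ⟩
    c * (g x * product (map g xs))  ∎
    where
    open ≡-Reasoning
    open +-*-Solver

  falling : ℕ → ℕ → ℕ
  falling m ℓ = (m C ℓ) * ℓ !

  falling-suc : ∀ m ℓ → falling m ℓ + ℓ * falling m (pred ℓ) ≡ falling (suc m) ℓ
  falling-suc m zero    = refl
  falling-suc m (suc ℓ) = begin
    (m C suc ℓ) * suc ℓ ! + suc ℓ * ((m C ℓ) * ℓ !)
      ≡⟨ solve 4 (λ a b l f → a :* (l :* f) :+ l :* (b :* f) := (b :+ a) :* (l :* f)) refl (m C suc ℓ) (m C ℓ) (suc ℓ) (ℓ !) ⟩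
    (m C ℓ + m C suc ℓ) * suc ℓ !
      ≡⟨ cong (_* suc ℓ !) (nCk+nC[k+1]≡[n+1]C[k+1] m ℓ) ⟩
    (suc m C suc ℓ) * suc ℓ ! ∎
    where
    open ≡-Reasoning
    open +-*-Solver

  module Rearrangements (B : ℕ) where

    E : List ℕ
    E = upTo (suc B)

    InRange : ℕ → Set
    InRange v = 1 ≤ v × v ≤ B

    symmetryFactor : List ℕ → ℕ
    symmetryFactor p = product (map (λ i → count (suc i) p !) (upTo B))

    symmetryFactor-[] : symmetryFactor [] ≡ 1
    symmetryFactor-[] = ones (upTo B)
      where
      ones : ∀ (xs : List ℕ) → product (map (λ i → count (suc i) [] !) xs) ≡ 1
      ones []       = refl
      ones (x ∷ xs) = trans (+-identityʳ _) (ones xs)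

    symmetryFactor-↭ : ∀ {p q} → p ↭ q → symmetryFactor p ≡ symmetryFactor q
    symmetryFactor-↭ p↭q = cong product (map-cong (λ i → cong _! (↭-length (filter-↭ (suc i ≟_) p↭q))) (upTo B))

    symmetryFactor-∷ : ∀ i p → i < B → symmetryFactor (suc i ∷ p) ≡ count (suc i) (suc i ∷ p) * symmetryFactor p
    symmetryFactor-∷ i p i<B = product-scale (count (suc i) (suc i ∷ p)) (Unique.upTo⁺ B) (∈-upTo⁺ i<B) at-i away
      where
      count-suc : count (suc i) (suc i ∷ p) ≡ suc (count (suc i) p)
      count-suc = trans (count-∷ (suc i) (suc i) p) (cong (_+ count (suc i) p) (⟦⟧-yes (suc i ≟ suc i) refl))
      at-i : count (suc i) (suc i ∷ p) ! ≡ count (suc i) (suc i ∷ p) * count (suc i) p !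
      at-i rewrite count-suc = refl
      away : ∀ j → j ≢ i → count (suc j) (suc i ∷ p) ! ≡ count (suc j) p !
      away j j≢i = cong _! (trans (count-∷ (suc j) (suc i) p)
        (cong (_+ count (suc j) p) (⟦⟧-no (suc j ≟ suc i) (j≢i ∘ suc-injective))))

    ∑-count : ∀ {p} → All InRange p → ∑ (upTo B) (λ i → count (suc i) p) ≡ length p
    ∑-count []                                      = ∑-zero (upTo B)
    ∑-count {suc v ∷ p} ((_ , v<B) ∷ inRange) = begin
      ∑ (upTo B) (λ i → count (suc i) (suc v ∷ p))
        ≡⟨ ∑-cong (upTo B) (λ i → trans (count-∷ (suc i) (suc v) p) (cong (_+ count (suc i) p)
             (⟦⟧-⇔ (suc i ≟ suc v) (i ≟ v) suc-injective (cong suc)))) ⟩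
      ∑ (upTo B) (λ i → ⟦ i ≟ v ⟧ + count (suc i) p)
        ≡⟨ ∑-+ (upTo B) _ _ ⟩
      ∑ (upTo B) (λ i → ⟦ i ≟ v ⟧) + ∑ (upTo B) (λ i → count (suc i) p)
        ≡⟨ cong₂ _+_ (∑-single (Unique.upTo⁺ B) (∈-upTo⁺ v<B)) (∑-count inRange) ⟩
      suc (length p) ∎
      where open ≡-Reasoning

    rearrangements : ℕ → List ℕ → ℕ
    rearrangements m p = ∑ (choices (pow m [ E ])) (λ es → ⟦ nonzeros es ↭? p ⟧)

    symmetryFactor*rearrangements : ∀ m {p} → All InRange p →
      symmetryFactor p * rearrangements m p ≡ falling m (length p)
    symmetryFactor*rearrangements zero    {[]}    [] = trans (*-identityʳ _) symmetryFactor-[]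
    symmetryFactor*rearrangements zero    {v ∷ p} _  = trans
      (cong (λ z → symmetryFactor (v ∷ p) * (z + 0)) (⟦⟧-no ([] ↭? v ∷ p) (¬x∷xs↭[] ∘ ↭-sym)))
      (trans (*-zeroʳ (symmetryFactor (v ∷ p))) (sym (cong (_* suc (length p) !) (k>n⇒nCk≡0 {0} {suc (length p)} (s≤s z≤n)))))
    symmetryFactor*rearrangements (suc m) {p} inRange = begin
      symmetryFactor p * rearrangements (suc m) p
        ≡⟨ cong (symmetryFactor p *_) split ⟩
      symmetryFactor p * (rearrangements m p + ∑ (upTo B) through)
        ≡⟨ *-distribˡ-+ (symmetryFactor p) _ _ ⟩
      symmetryFactor p * rearrangements m p + symmetryFactor p * ∑ (upTo B) through
        ≡⟨ cong₂ _+_ (symmetryFactor*rearrangements m inRange) (sym (∑-*ˡ (symmetryFactor p) (upTo B) through)) ⟩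
      falling m (length p) + ∑ (upTo B) (λ i → symmetryFactor p * through i)
        ≡⟨ cong (λ z → falling m (length p) + z) (∑-cong-∈ (upTo B) (λ i i∈ → through-count i (∈-upTo⁻ i∈))) ⟩
      falling m (length p) + ∑ (upTo B) (λ i → count (suc i) p * falling m (pred (length p)))
        ≡⟨ cong (λ z → falling m (length p) + z) (trans (∑-*ʳ _ (upTo B) _) (cong (_* falling m (pred (length p))) (∑-count inRange))) ⟩
      falling m (length p) + length p * falling m (pred (length p))
        ≡⟨ falling-suc m (length p) ⟩
      falling (suc m) (length p) ∎
      where
      open ≡-Reasoning

      through : ℕ → ℕ
      through i = ∑ (choices (pow m [ E ])) (λ es → ⟦ suc i ∷ nonzeros es ↭? p ⟧)

      split : rearrangements (suc m) p ≡ rearrangements m p + ∑ (upTo B) through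
      split = trans (∑-choices-∷ E (pow m [ E ]) _)
        (cong (λ xs → rearrangements m p + sum xs)
          (trans (map-applyUpTo suc _ B) (sym (map-applyUpTo (λ i → i) through B))))

      through-∈ : ∀ i → i < B → Dec (suc i ∈ p) →
        symmetryFactor p * through i ≡ count (suc i) p * falling m (pred (length p))
      through-∈ i i<B (no i∉) = trans
        (cong (symmetryFactor p *_) (trans
          (∑-cong (choices (pow m [ E ])) (λ es → ⟦⟧-no (suc i ∷ nonzeros es ↭? p) (λ q → i∉ (∈-resp-↭ q (here refl)))))
          (∑-zero (choices (pow m [ E ])))))
        (trans (*-zeroʳ (symmetryFactor p)) (sym (cong (_* falling m (pred (length p))) (count-∉ (suc i) p i∉))))
      through-∈ i i<B (yes i∈) with as , bs , eq ← ∈-∃++ i∈ = begin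
        symmetryFactor p * through i
          ≡⟨ cong₂ _*_ (trans (symmetryFactor-↭ p↭) (symmetryFactor-∷ i p′ i<B))
               (∑-cong (choices (pow m [ E ])) (λ es → ⟦⟧-⇔ (suc i ∷ nonzeros es ↭? p) (nonzeros es ↭? p′)
                 (λ q → drop-∷ (↭-trans q p↭)) (λ q → ↭-trans (prep (suc i) q) (↭-sym p↭)))) ⟩
        count (suc i) (suc i ∷ p′) * symmetryFactor p′ * rearrangements m p′
          ≡⟨ *-assoc (count (suc i) (suc i ∷ p′)) _ _ ⟩
        count (suc i) (suc i ∷ p′) * (symmetryFactor p′ * rearrangements m p′)
          ≡⟨ cong₂ _*_ (↭-length (filter-↭ (suc i ≟_) (↭-sym p↭)))
               (symmetryFactor*rearrangements m (All.tail (All-resp-↭ p↭ inRange))) ⟩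
        count (suc i) p * falling m (length p′)
          ≡⟨ cong (λ z → count (suc i) p * falling m (pred z)) (↭-length p↭) ⟨
        count (suc i) p * falling m (pred (length p)) ∎
        where
        p′ : List ℕ
        p′ = as ++ bs
        p↭ : p ↭ suc i ∷ p′
        p↭ = ↭-trans (↭-reflexive eq) (shift (suc i) as bs)

      through-count : ∀ i → i < B → symmetryFactor p * through i ≡ count (suc i) p * falling m (pred (length p))
      through-count i i<B = through-∈ i i<B (suc i ∈? p)

    -- By symmetry each of the m + 1 entries contributes equally to the total sum of p.
    first-entry-sum : ∀ m p →
      suc m * ∑ E (λ e → e * ∑ (choices (pow m [ E ])) (λ es → ⟦ closeRun e (nonzeros es) ↭? p ⟧)) ≡
      sum p * rearrangements (suc m) p
    first-entry-sum m p = begin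
      suc m * ∑ E (λ e → e * ∑ (choices (pow m [ E ])) (λ es → ψ (e ∷ es)))
        ≡⟨ cong (suc m *_) (∑-cong E (λ e → trans (cong (_* ∑ (choices (pow m [ E ])) (λ es → ψ (e ∷ es))) (sym (+-identityʳ e)))
             (sym (∑-*ˡ (e + 0) (choices (pow m [ E ])) (λ es → ψ (e ∷ es)))))) ⟩
      suc m * ∑ E (λ e → ∑ (choices (pow m [ E ])) (λ es → W (e ∷ []) * ψ (e ∷ es)))
        ≡⟨ cong (suc m *_) (trans (∑-choices-∷ E [] _) (∑-cong E (λ e → +-identityʳ _))) ⟨
      suc m * ∑ (choices [ E ]) (λ u → ∑ (choices (pow m [ E ])) (λ es → W u * ψ (u ++ es)))
        ≡⟨ first-block-sum [ E ] m {ψ} (λ es↭ → ⟦↭⟧-cong (nonzeros-↭ es↭) ↭-refl) ⟨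
      ∑ (choices (pow (suc m) [ E ])) (λ es → W es * ψ es)
        ≡⟨ ∑-cong (choices (pow (suc m) [ E ])) weight ⟩
      ∑ (choices (pow (suc m) [ E ])) (λ es → sum p * ψ es)
        ≡⟨ ∑-*ˡ (sum p) (choices (pow (suc m) [ E ])) ψ ⟩
      sum p * rearrangements (suc m) p ∎
      where
      open ≡-Reasoning
      open Weighted (λ e → e) using (W; first-block-sum)
      ψ : List ℕ → ℕ
      ψ es = ⟦ nonzeros es ↭? p ⟧
      weight : ∀ es → W es * ψ es ≡ sum p * ψ es
      weight es with nonzeros es ↭? p
      ... | no _  = trans (*-zeroʳ (W es)) (sym (*-zeroʳ (sum p)))
      ... | yes q = cong (_* 1) (trans (cong sum (map-id es)) (trans (sym (sum-nonzeros es)) (sum-↭ q)))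

  applyDownFrom-cong-< : ∀ {f g : ℕ → A} n → (∀ i → i < n → f i ≡ g i) → applyDownFrom f n ≡ applyDownFrom g n
  applyDownFrom-cong-< zero    eq = refl
  applyDownFrom-cong-< (suc n) eq = cong₂ _∷_ (eq n ≤-refl) (applyDownFrom-cong-< n (λ i i<n → eq i (m<n⇒m<1+n i<n)))

  applyDownFrom-+ : ∀ (f : ℕ → A) m n →
    applyDownFrom f (m + n) ≡ applyDownFrom (λ i → f (i + n)) m ++ applyDownFrom f n
  applyDownFrom-+ f zero    n = refl
  applyDownFrom-+ f (suc m) n = cong (f (m + n) ∷_) (applyDownFrom-+ f m n)

  periodic-* : ∀ {f : ℕ → A} {k} → (∀ i → f (i + k) ≡ f i) → ∀ n i → f (i + n * k) ≡ f i
  periodic-* {f = f}     per zero    i = cong f (+-identityʳ i)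
  periodic-* {f = f} {k} per (suc n) i = begin
    f (i + (k + n * k))  ≡⟨ cong f (+-assoc i k (n * k)) ⟨
    f (i + k + n * k)    ≡⟨ periodic-* per n (i + k) ⟩
    f (i + k)            ≡⟨ per i ⟩
    f i                  ∎
    where open ≡-Reasoning

  applyDownFrom-periodic : ∀ {f : ℕ → A} {k} → (∀ i → f (i + k) ≡ f i) → ∀ n →
    applyDownFrom f (n * k) ≡ pow n (applyDownFrom f k)
  applyDownFrom-periodic             per zero    = refl
  applyDownFrom-periodic {f = f} {k} per (suc n) = trans (applyDownFrom-+ f k (n * k))
    (cong₂ _++_ (applyDownFrom-cong-< k (λ i _ → periodic-* per n i)) (applyDownFrom-periodic per n))

  ∑-pow : ∀ n (xs : List A) f → ∑ (pow n xs) f ≡ n * ∑ xs f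
  ∑-pow zero    xs f = refl
  ∑-pow (suc n) xs f = trans (∑-++ xs (pow n xs) f) (cong (∑ xs f +_) (∑-pow n xs f))

  map-pow : ∀ {B : Set} (f : A → B) n xs → map f (pow n xs) ≡ pow n (map f xs)
  map-pow f zero    xs = refl
  map-pow f (suc n) xs = trans (map-++ f xs (pow n xs)) (cong (map f xs ++_) (map-pow f n xs))

  -- A diagonal flag paired with the length of the neighbouring east run.
  Letter : Set
  Letter = Bool × ℕ

  wt : Letter → ℕ
  wt (b , e) = bit b + e

  open Weighted wt

  flags : List Letter → List Bool
  flags = map proj₁

  runs : List Letter → List ℕ
  runs = map proj₂

  diagonalCount : List Letter → ℕ
  diagonalCount l = ∑ (flags l) bit

  weight-split : ∀ l → ∑ l wt ≡ diagonalCount l + sum (runs l)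
  weight-split []            = refl
  weight-split ((b , e) ∷ l) = trans (cong (bit b + e +_) (weight-split l))
    (solve 4 (λ b e d s → b :+ e :+ (d :+ s) := b :+ d :+ (e :+ s)) refl (bit b) e (diagonalCount l) (sum (runs l)))
    where open +-*-Solver

  module Counting (k n B : ℕ) (p : List ℕ) where

    open Rearrangements B

    letters : Bool → List Letter
    letters b = cartesianProduct (steps b) E

    below : (l : List Letter) → Dec (Below k l)
    below = below? k

    Balanced : List Letter → Set
    Balanced l = diagonalCount l + sum p ≡ n

    HasRuns : List Letter → Set
    HasRuns l = nonzeros (runs l) ↭ p

    Good : List Letter → Set
    Good l = Below k l × Balanced l × HasRuns l

    typed? : ∀ l → Dec (Balanced l × HasRuns l)
    typed? l = (diagonalCount l + sum p ≟ n) ×-dec (nonzeros (runs l) ↭? p)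

    good? : ∀ l → Dec (Good l)
    good? l = below l ×-dec typed? l

    φ : List Letter → ℕ
    φ l = ⟦ diagonalCount l + sum p ≟ n ⟧ * ⟦ nonzeros (runs l) ↭? p ⟧

    Symmetric-φ : Symmetric φ
    Symmetric-φ {u} {v} u↭v = cong₂ _*_
      (cong (λ z → ⟦ z + sum p ≟ n ⟧) (sum-↭ (↭-map⁺ bit (↭-map⁺ proj₁ u↭v))))
      (⟦↭⟧-cong {nonzeros (runs u)} (nonzeros-↭ (↭-map⁺ proj₂ u↭v)) ↭-refl)

    weight-good : ∀ l → Balanced l → HasRuns l → W l ≡ n
    weight-good l bal has = trans (weight-split l)
      (trans (cong (diagonalCount l +_) (trans (sym (sum-nonzeros (runs l))) (sum-↭ has))) bal)

    φ-support : ∀ l → φ l ≢ 0 → W l ≡ n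
    φ-support l φ≢0 = weight-good l
      (⟦⟧-≢0 (diagonalCount l + sum p ≟ n) (λ eq → φ≢0 (cong (_* ⟦ nonzeros (runs l) ↭? p ⟧) eq)))
      (⟦⟧-≢0 (nonzeros (runs l) ↭? p) (λ eq → φ≢0 (trans (cong (⟦ diagonalCount l + sum p ≟ n ⟧ *_) eq)
        (*-zeroʳ ⟦ diagonalCount l + sum p ≟ n ⟧))))

    good-φ : ∀ l → ⟦ good? l ⟧ ≡ ⟦ below l ⟧ * φ l
    good-φ l = trans (⟦⟧-× (below l) (typed? l)) (cong (⟦ below l ⟧ *_) (⟦⟧-× (diagonalCount l + sum p ≟ n) (nonzeros (runs l) ↭? p)))

    ∑-letters : ∀ bs (F : List Bool → ℕ) (G : List ℕ → ℕ) →
      ∑ (choices (map letters bs)) (λ l → F (flags l) * G (runs l)) ≡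
      ∑ (choices (map steps bs)) F * ∑ (choices (pow (length bs) [ E ])) G
    ∑-letters []       F G = begin
      F [] * G [] + 0          ≡⟨ +-identityʳ _ ⟩
      F [] * G []              ≡⟨ cong₂ _*_ (+-identityʳ (F [])) (+-identityʳ (G [])) ⟨
      (F [] + 0) * (G [] + 0)  ∎
      where open ≡-Reasoning
    ∑-letters (b ∷ bs) F G = begin
      ∑ (choices (letters b ∷ map letters bs)) (λ l → F (flags l) * G (runs l))
        ≡⟨ ∑-choices-∷ (letters b) (map letters bs) _ ⟩
      ∑ (letters b) (λ x → ∑ (choices (map letters bs)) (λ l → F (proj₁ x ∷ flags l) * G (proj₂ x ∷ runs l)))
        ≡⟨ ∑-cong (letters b) (λ x → ∑-letters bs (λ ds → F (proj₁ x ∷ ds)) (λ es → G (proj₂ x ∷ es))) ⟩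
      ∑ (letters b) (λ x → F′ (proj₁ x) * G′ (proj₂ x))
        ≡⟨ ∑-cartesianProductWith _,_ (steps b) E _ ⟩
      ∑ (steps b) (λ s → ∑ E (λ e → F′ s * G′ e))
        ≡⟨ ∑-cong (steps b) (λ s → ∑-*ˡ (F′ s) E G′) ⟩
      ∑ (steps b) (λ s → F′ s * ∑ E G′)
        ≡⟨ ∑-*ʳ (∑ E G′) (steps b) F′ ⟩
      ∑ (steps b) F′ * ∑ E G′
        ≡⟨ cong₂ _*_ (∑-choices-∷ (steps b) (map steps bs) F) (∑-choices-∷ E (pow (length bs) [ E ]) G) ⟨
      ∑ (choices (map steps (b ∷ bs))) F * ∑ (choices (pow (length (b ∷ bs)) [ E ])) G ∎
      where
      open ≡-Reasoning
      F′ : Bool → ℕ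
      F′ s = ∑ (choices (map steps bs)) (λ ds → F (s ∷ ds))
      G′ : ℕ → ℕ
      G′ e = ∑ (choices (pow (length bs) [ E ])) (λ es → G (e ∷ es))

    module Periodic .{{_ : NonZero k}} (f : ℕ → Bool) (per : ∀ i → f (i + k) ≡ f i) where

      bits : List Bool
      bits = applyDownFrom f (n * k)

      words : List (List Letter)
      words = choices (map letters bits)

      allowed : ℕ
      allowed = ∑ bits bit

      goodCount : List Letter → ℕ
      goodCount hs = ∑ hs (λ h → ∑ words (λ l → ⟦ good? (h ∷ l) ⟧))

      stepSum : Bool → ℕ
      stepSum b = ∑ (choices (map steps bits)) (λ ds → ⟦ bit b + ∑ ds bit + sum p ≟ n ⟧)

      runSum : ℕ → ℕ
      runSum e = ∑ (choices (pow (n * k) [ E ])) (λ es → ⟦ closeRun e (nonzeros es) ↭? p ⟧)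

      goodCount-head : ∀ h → n * ∑ words (λ l → ⟦ good? (h ∷ l) ⟧) ≡ wt h * (stepSum (proj₁ h) * runSum (proj₂ h))
      goodCount-head h = begin
        n * ∑ words (λ l → ⟦ good? (h ∷ l) ⟧)
          ≡⟨ cong (n *_) (∑-cong-∈ words drop-head) ⟩
        n * ∑ words (λ l → ⟦ below l ⟧ * φ (h ∷ l))
          ≡⟨ cong (λ As → n * ∑ (choices As) (λ l → ⟦ below l ⟧ * φ (h ∷ l))) words≡pow ⟩
        n * ∑ (choices (pow n block)) (λ l → ⟦ below l ⟧ * φ (h ∷ l))
          ≡⟨ cycle-lemma k block length-block n (wt h) (Symmetric-φ ∘ prep h)
               (λ l φ≢0 → trans (+-comm (W l) (wt h)) (φ-support (h ∷ l) φ≢0)) ⟩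
        wt h * ∑ (choices (pow n block)) (λ l → φ (h ∷ l))
          ≡⟨ cong (λ As → wt h * ∑ (choices As) (λ l → φ (h ∷ l))) words≡pow ⟨
        wt h * ∑ words (λ l → φ (h ∷ l))
          ≡⟨ cong (wt h *_) (∑-letters bits
               (λ ds → ⟦ bit (proj₁ h) + ∑ ds bit + sum p ≟ n ⟧) (λ es → ⟦ closeRun (proj₂ h) (nonzeros es) ↭? p ⟧)) ⟩
        wt h * (stepSum (proj₁ h) * ∑ (choices (pow (length bits) [ E ])) (λ es → ⟦ closeRun (proj₂ h) (nonzeros es) ↭? p ⟧))
          ≡⟨ cong (λ m → wt h * (stepSum (proj₁ h) * ∑ (choices (pow m [ E ])) (λ es → ⟦ closeRun (proj₂ h) (nonzeros es) ↭? p ⟧)))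
               (length-applyDownFrom f (n * k)) ⟩
        wt h * (stepSum (proj₁ h) * runSum (proj₂ h)) ∎
        where
        open ≡-Reasoning
        block : List (List Letter)
        block = map letters (applyDownFrom f k)

        length-block : length block ≡ k
        length-block = trans (length-map letters (applyDownFrom f k)) (length-applyDownFrom f k)

        words≡pow : map letters bits ≡ pow n block
        words≡pow = trans (cong (map letters) (applyDownFrom-periodic per n)) (map-pow letters n _)

        length-word : ∀ {l} → l ∈ words → length l ≡ n * k
        length-word l∈ = trans (length-choices (map letters bits) l∈)
          (trans (length-map letters bits) (length-applyDownFrom f (n * k)))

        drop-head : ∀ l → l ∈ words → ⟦ good? (h ∷ l) ⟧ ≡ ⟦ below l ⟧ * φ (h ∷ l)
        drop-head l l∈ with φ (h ∷ l) ≟ 0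
        ... | yes eq = trans (good-φ (h ∷ l)) (trans (vanish (below (h ∷ l))) (sym (vanish (below l))))
          where
          vanish : ∀ {P : Set} (P? : Dec P) → ⟦ P? ⟧ * φ (h ∷ l) ≡ 0
          vanish P? = trans (cong (⟦ P? ⟧ *_) eq) (*-zeroʳ ⟦ P? ⟧)
        ... | no neq = trans (good-φ (h ∷ l)) (cong (_* φ (h ∷ l))
          (⟦⟧-⇔ (below (h ∷ l)) (below l) proj₂ (λ bel → s≤s (≤-reflexive
            (trans (cong (k *_) (φ-support (h ∷ l) neq)) (trans (*-comm k n) (sym (length-word l∈))))) , bel)))

      contribution : Letter → ℕ
      contribution h = wt h * (stepSum (proj₁ h) * runSum (proj₂ h))

      goodCount-∑ : ∀ hs → n * goodCount hs ≡ ∑ hs contribution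
      goodCount-∑ hs = trans (sym (∑-*ˡ n hs _)) (∑-cong hs goodCount-head)

      stepSum-false : stepSum false ≡ binom allowed (ℤ.+ n ℤ.- ℤ.+ sum p)
      stepSum-false = ∑-steps-binom bits n (sum p)

      stepSum-true : .{{_ : NonZero n}} → stepSum true ≡ binom allowed (ℤ.+ n ℤ.- ℤ.+ 1 ℤ.- ℤ.+ sum p)
      stepSum-true = lower n refl
        where
        lower : ∀ m → .{{_ : NonZero m}} → m ≡ n →
          ∑ (choices (map steps bits)) (λ ds → ⟦ suc (∑ ds bit + sum p) ≟ m ⟧) ≡ binom allowed (ℤ.+ m ℤ.- ℤ.+ 1 ℤ.- ℤ.+ sum p)
        lower (suc m) _ = trans
          (∑-cong (choices (map steps bits)) (λ ds →
            ⟦⟧-⇔ (suc (∑ ds bit + sum p) ≟ suc m) (∑ ds bit + sum p ≟ m) suc-injective (cong suc)))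
          (∑-steps-binom bits m (sum p))

      stepSum-both : stepSum false + stepSum true ≡ binom (suc allowed) (ℤ.+ n ℤ.- ℤ.+ sum p)
      stepSum-both = trans (cong (stepSum false +_) (sym (+-identityʳ _)))
        (trans (sym (∑-choices-∷ (steps true) (map steps bits) (λ ds → ⟦ ∑ ds bit + sum p ≟ n ⟧)))
               (∑-steps-binom (true ∷ bits) n (sum p)))

      ∑-runSum : ∑ E runSum ≡ rearrangements (suc (n * k)) p
      ∑-runSum = sym (∑-choices-∷ E (pow (n * k) [ E ]) (λ es → ⟦ nonzeros es ↭? p ⟧))

      module _ (inRange : All InRange p) where

        private
          s m c : ℕ
          s = symmetryFactor p
          m = suc (n * k)
          c = sum p
          V : ℕ
          V = ∑ E (λ e → e * runSum e)

          s*m*V : s * m * V ≡ c * falling m (length p)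
          s*m*V = begin
            s * m * V                         ≡⟨ *-assoc s m V ⟩
            s * (m * V)                       ≡⟨ cong (s *_) (first-entry-sum (n * k) p) ⟩
            s * (c * rearrangements m p)      ≡⟨ solve 3 (λ s c r → s :* (c :* r) := c :* (s :* r)) refl s c (rearrangements m p) ⟩
            c * (s * rearrangements m p)      ≡⟨ cong (c *_) (symmetryFactor*rearrangements m inRange) ⟩
            c * falling m (length p)          ∎
            where
            open ≡-Reasoning
            open +-*-Solver

        goodCount-north : s * m * (n * goodCount (cartesianProduct [ false ] E)) ≡
          c * (binom allowed (ℤ.+ n ℤ.- ℤ.+ c) * falling m (length p))
        goodCount-north = begin
          s * m * (n * goodCount (cartesianProduct [ false ] E))
            ≡⟨ cong (s * m *_) (trans (goodCount-∑ (cartesianProduct [ false ] E)) (trans (∑-cartesianProductWith _,_ [ false ] E contribution) (+-identityʳ _))) ⟩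
          s * m * ∑ E (λ e → e * (stepSum false * runSum e))
            ≡⟨ cong (s * m *_) (trans (∑-cong E (λ e →
                 solve 3 (λ e d r → e :* (d :* r) := d :* (e :* r)) refl e (stepSum false) (runSum e))) (∑-*ˡ (stepSum false) E (λ e → e * runSum e))) ⟩
          s * m * (stepSum false * V)
            ≡⟨ solve 3 (λ a d v → a :* (d :* v) := d :* (a :* v)) refl (s * m) (stepSum false) V ⟩
          stepSum false * (s * m * V)
            ≡⟨ cong₂ _*_ stepSum-false s*m*V ⟩
          binom allowed (ℤ.+ n ℤ.- ℤ.+ c) * (c * falling m (length p))
            ≡⟨ solve 3 (λ d c r → d :* (c :* r) := c :* (d :* r)) refl (binom allowed (ℤ.+ n ℤ.- ℤ.+ c)) c (falling m (length p)) ⟩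
          c * (binom allowed (ℤ.+ n ℤ.- ℤ.+ c) * falling m (length p)) ∎
          where
          open ≡-Reasoning
          open +-*-Solver

        goodCount-all : .{{_ : NonZero n}} → s * m * (n * goodCount (letters true)) ≡
          (m * binom allowed (ℤ.+ n ℤ.- ℤ.+ 1 ℤ.- ℤ.+ c) + c * binom (suc allowed) (ℤ.+ n ℤ.- ℤ.+ c)) * falling m (length p)
        goodCount-all = begin
          s * m * (n * goodCount (letters true))
            ≡⟨ cong (s * m *_) (trans (goodCount-∑ (letters true)) (∑-cartesianProductWith _,_ (steps true) E contribution)) ⟩
          s * m * (∑ E (λ e → e * (D₀ * runSum e)) + (∑ E (λ e → suc e * (D₁ * runSum e)) + 0))
            ≡⟨ cong (s * m *_) (trans (cong (∑ E (λ e → e * (D₀ * runSum e)) +_) (+-identityʳ _)) (sym (∑-+ E (λ e → e * (D₀ * runSum e)) (λ e → suc e * (D₁ * runSum e))))) ⟩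
          s * m * ∑ E (λ e → e * (D₀ * runSum e) + suc e * (D₁ * runSum e))
            ≡⟨ cong (s * m *_) (∑-cong E (λ e → solve 4 (λ e a b r →
                 e :* (a :* r) :+ (con 1 :+ e) :* (b :* r) := (a :+ b) :* (e :* r) :+ b :* r) refl e D₀ D₁ (runSum e))) ⟩
          s * m * ∑ E (λ e → (D₀ + D₁) * (e * runSum e) + D₁ * runSum e)
            ≡⟨ cong (s * m *_) (trans (∑-+ E (λ e → (D₀ + D₁) * (e * runSum e)) (λ e → D₁ * runSum e))
                 (cong₂ _+_ (∑-*ˡ (D₀ + D₁) E (λ e → e * runSum e)) (∑-*ˡ D₁ E runSum))) ⟩
          s * m * ((D₀ + D₁) * V + D₁ * ∑ E runSum)
            ≡⟨ solve 6 (λ s m d v b r → s :* m :* (d :* v :+ b :* r) := d :* (s :* m :* v) :+ m :* b :* (s :* r))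
                 refl s m (D₀ + D₁) V D₁ (∑ E runSum) ⟩
          (D₀ + D₁) * (s * m * V) + m * D₁ * (s * ∑ E runSum)
            ≡⟨ cong₂ _+_ (cong ((D₀ + D₁) *_) s*m*V)
                 (cong (m * D₁ *_) (trans (cong (s *_) ∑-runSum) (symmetryFactor*rearrangements m inRange))) ⟩
          (D₀ + D₁) * (c * falling m (length p)) + m * D₁ * falling m (length p)
            ≡⟨ solve 5 (λ d c g m b → d :* (c :* g) :+ m :* b :* g := (m :* b :+ c :* d) :* g)
                 refl (D₀ + D₁) c (falling m (length p)) m D₁ ⟩
          (m * D₁ + c * (D₀ + D₁)) * falling m (length p)
            ≡⟨ cong₂ (λ x y → (m * x + c * y) * falling m (length p)) stepSum-true stepSum-both ⟩
          (m * binom allowed (ℤ.+ n ℤ.- ℤ.+ 1 ℤ.- ℤ.+ c) + c * binom (suc allowed) (ℤ.+ n ℤ.- ℤ.+ c)) * falling m (length p) ∎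
          where
          open ≡-Reasoning
          open +-*-Solver
          D₀ D₁ : ℕ
          D₀ = stepSum false
          D₁ = stepSum true

        goodCount-diagonal : .{{_ : NonZero n}} → s * (n * goodCount [ (true , 0) ]) ≡
          binom allowed (ℤ.+ n ℤ.- ℤ.+ 1 ℤ.- ℤ.+ c) * falling (n * k) (length p)
        goodCount-diagonal = begin
          s * (n * goodCount [ (true , 0) ])
            ≡⟨ cong (s *_) (goodCount-∑ [ (true , 0) ]) ⟩
          s * (1 * (stepSum true * runSum 0) + 0)
            ≡⟨ solve 3 (λ s d r → s :* (con 1 :* (d :* r) :+ con 0) := d :* (s :* r)) refl s (stepSum true) (runSum 0) ⟩
          stepSum true * (s * runSum 0)
            ≡⟨ cong₂ _*_ stepSum-true (symmetryFactor*rearrangements (n * k) inRange) ⟩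
          binom allowed (ℤ.+ n ℤ.- ℤ.+ 1 ℤ.- ℤ.+ c) * falling (n * k) (length p) ∎
          where
          open ≡-Reasoning
          open +-*-Solver

  lookup-injective : ∀ {xs : List A} → Unique xs → ∀ i j → lookup xs i ≡ lookup xs j → i ≡ j
  lookup-injective (_ ∷ _)  Fin.zero    Fin.zero    _  = refl
  lookup-injective (x∉ ∷ _) Fin.zero    (Fin.suc j) eq = ⊥-elim (All.lookup x∉ (∈-lookup j) eq)
  lookup-injective (x∉ ∷ _) (Fin.suc i) Fin.zero    eq = ⊥-elim (All.lookup x∉ (∈-lookup i) (sym eq))
  lookup-injective (_ ∷ u)  (Fin.suc i) (Fin.suc j) eq = cong Fin.suc (lookup-injective u i j eq)

  Refinement-≡ : ∀ {P : A → Set} {r s : Refinement A P} → Refinement.value r ≡ Refinement.value s → r ≡ s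
  Refinement-≡ refl = refl

  refinement↔Fin : ∀ {P : A → Set} (R : A → X → Set) (xs : List X) → Unique xs →
    (∀ a x → Dec (R a x)) →
    (∀ {a a′ x} → R a x → R a′ x → a ≡ a′) →
    (∀ {a x x′} → R a x → R a x′ → x ≡ x′) →
    (∀ {a} → P a → ∃[ x ] (x ∈ xs × R a x)) →
    (∀ {x} → x ∈ xs → ∃[ a ] (P a × R a x)) →
    Refinement A P ↔ Fin (length xs)
  refinement↔Fin {A = A} {P = P} R xs unique R? determ injective encode decode =
    mk↔ₛ′ to from to∘from from∘to
    where
    encoded : ∀ a → .(P a) → Any (R a) xs
    encoded a p = recompute (Any.any? (R? a) xs) (found (encode p))
      where
      found : ∃[ x ] (x ∈ xs × R a x) → Any (R a) xs
      found (x , x∈ , r) = Any.map (λ { refl → r }) x∈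
    to : Refinement A P → Fin (length xs)
    to (a , irrelevant p) = Any.index (encoded a p)
    decoded : ∀ i → ∃[ a ] (P a × R a (lookup xs i))
    decoded i = decode (∈-lookup i)
    from : Fin (length xs) → Refinement A P
    from i = proj₁ (decoded i) , irrelevant (proj₁ (proj₂ (decoded i)))
    to∘from : ∀ i → to (from i) ≡ i
    to∘from i = lookup-injective unique _ i
      (injective (lookup-index (encoded (proj₁ (decoded i)) (proj₁ (proj₂ (decoded i))))) (proj₂ (proj₂ (decoded i))))
    from∘to : ∀ r → from (to r) ≡ r
    from∘to (a , irrelevant p) = Refinement-≡ (determ (proj₂ (proj₂ (decoded (to (a , irrelevant p))))) (lookup-index (encoded a p)))

  -- Words

  step : Bool → Step
  step true  = diagonal
  step false = north

  easts : ℕ → Path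
  easts e = replicate e east

  step-injective : ∀ {b b′} → step b ≡ step b′ → b ≡ b′
  step-injective {true}  {true}  _ = refl
  step-injective {false} {false} _ = refl

  step≢east : ∀ b → step b ≢ east
  step≢east true  ()
  step≢east false ()

  eastsThen thenEasts : Letter → Path
  eastsThen (b , e) = easts e ++ [ step b ]
  thenEasts (b , e) = step b ∷ easts e

  -- Letters are listed from the top of the path to its bottom.
  word : (Letter → Path) → List Letter → Path
  word g l = concatMap g (reverse l)

  word-∷ : ∀ g x l → word g (x ∷ l) ≡ word g l ++ g x
  word-∷ g x l = begin
    concatMap g (reverse (x ∷ l))          ≡⟨ cong (concatMap g) (unfold-reverse x l) ⟩
    concatMap g (reverse l ∷ʳ x)           ≡⟨ concatMap-++ g (reverse l) [ x ] ⟩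
    word g l ++ (g x ++ [])                ≡⟨ cong (word g l ++_) (++-identityʳ (g x)) ⟩
    word g l ++ g x                        ∎
    where open ≡-Reasoning

  word-injective : ∀ {g} → (∀ {l l′} → concatMap g l ≡ concatMap g l′ → l ≡ l′) →
    ∀ {l l′} → word g l ≡ word g l′ → l ≡ l′
  word-injective inj eq = reverse-injective (inj eq)

  eastsThen-split : ∀ b e r → eastsThen (b , e) ++ r ≡ easts e ++ step b ∷ r
  eastsThen-split b e r = ++-assoc (easts e) [ step b ] r

  easts-step-injective : ∀ {b b′} e e′ {r r′} → easts e ++ step b ∷ r ≡ easts e′ ++ step b′ ∷ r′ →
    (b , e) ≡ (b′ , e′) × r ≡ r′
  easts-step-injective zero zero eq with eq₁ , eq₂ ← ∷-injective eq = cong (_, 0) (step-injective eq₁) , eq₂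
  easts-step-injective {b} zero (suc e′) eq = ⊥-elim (step≢east b (∷-injectiveˡ eq))
  easts-step-injective {b′ = b′} (suc e) zero eq = ⊥-elim (step≢east b′ (sym (∷-injectiveˡ eq)))
  easts-step-injective (suc e) (suc e′) eq
    with refl , eq′ ← easts-step-injective e e′ (∷-injectiveʳ eq) = refl , eq′

  concatMap-eastsThen-injective : ∀ {l l′} → concatMap eastsThen l ≡ concatMap eastsThen l′ → l ≡ l′
  concatMap-eastsThen-injective {[]} {[]} _ = refl
  concatMap-eastsThen-injective {[]} {(b , zero) ∷ l′} ()
  concatMap-eastsThen-injective {[]} {(b , suc e) ∷ l′} ()
  concatMap-eastsThen-injective {(b , zero) ∷ l} {[]} ()
  concatMap-eastsThen-injective {(b , suc e) ∷ l} {[]} ()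
  concatMap-eastsThen-injective {(b , e) ∷ l} {(b′ , e′) ∷ l′} eq
    with eq₁ , eq₂ ← easts-step-injective e e′
           (trans (sym (eastsThen-split b e _)) (trans eq (eastsThen-split b′ e′ _)))
    = cong₂ _∷_ eq₁ (concatMap-eastsThen-injective eq₂)

  concatMap-thenEasts≢east : ∀ l {r} → concatMap thenEasts l ≢ east ∷ r
  concatMap-thenEasts≢east ((b , e) ∷ l) eq = step≢east b (∷-injectiveˡ eq)

  easts-thenEasts-injective : ∀ e e′ l l′ →
    easts e ++ concatMap thenEasts l ≡ easts e′ ++ concatMap thenEasts l′ →
    e ≡ e′ × concatMap thenEasts l ≡ concatMap thenEasts l′
  easts-thenEasts-injective zero    zero     l l′ eq = refl , eq
  easts-thenEasts-injective zero    (suc e′) l l′ eq = ⊥-elim (concatMap-thenEasts≢east l eq)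
  easts-thenEasts-injective (suc e) zero     l l′ eq = ⊥-elim (concatMap-thenEasts≢east l′ (sym eq))
  easts-thenEasts-injective (suc e) (suc e′) l l′ eq
    with refl , eq′ ← easts-thenEasts-injective e e′ l l′ (∷-injectiveʳ eq) = refl , eq′

  concatMap-thenEasts-injective : ∀ {l l′} → concatMap thenEasts l ≡ concatMap thenEasts l′ → l ≡ l′
  concatMap-thenEasts-injective {[]}    {[]}     _ = refl
  concatMap-thenEasts-injective {[]}    {_ ∷ _}  ()
  concatMap-thenEasts-injective {_ ∷ _} {[]}     ()
  concatMap-thenEasts-injective {(b , e) ∷ l} {(b′ , e′) ∷ l′} eq
    with eq₁ , eq₂ ← ∷-injective eq
    with refl , eq₃ ← easts-thenEasts-injective e e′ l l′ eq₂
    = cong₂ _∷_ (cong (_, e) (step-injective eq₁)) (concatMap-thenEasts-injective eq₃)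

  parse-eastsThen : ∀ w → ∃[ b ] ∃[ e ] ∃[ ls ] w ++ [ north ] ≡ concatMap eastsThen ((b , e) ∷ ls)
  parse-eastsThen []             = false , 0 , [] , refl
  parse-eastsThen (east ∷ w)     with b , e , ls , eq ← parse-eastsThen w = b , suc e , ls , cong (east ∷_) eq
  parse-eastsThen (north ∷ w)    with b , e , ls , eq ← parse-eastsThen w = false , 0 , (b , e) ∷ ls , cong (north ∷_) eq
  parse-eastsThen (diagonal ∷ w) with b , e , ls , eq ← parse-eastsThen w = true , 0 , (b , e) ∷ ls , cong (diagonal ∷_) eq

  parse-thenEasts : ∀ b w → ∃[ e ] ∃[ ls ] step b ∷ w ≡ concatMap thenEasts ((b , e) ∷ ls)
  parse-thenEasts b []             = 0 , [] , refl
  parse-thenEasts b (east ∷ w)     with e , ls , eq ← parse-thenEasts b w =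
    suc e , ls , cong (λ v → step b ∷ east ∷ v) (∷-injectiveʳ eq)
  parse-thenEasts b (north ∷ w)    with e , ls , eq ← parse-thenEasts false w = 0 , (false , e) ∷ ls , cong (step b ∷_) eq
  parse-thenEasts b (diagonal ∷ w) with e , ls , eq ← parse-thenEasts true w = 0 , (true , e) ∷ ls , cong (step b ∷_) eq

  -- Lattice points of a path

  visited : Point → Path → List Point
  visited p []      = []
  visited p (s ∷ w) = points (move p s) w

  points-visited : ∀ p w → points p w ≡ p ∷ visited p w
  points-visited p []      = refl
  points-visited p (s ∷ w) = refl

  points-++ : ∀ p u v → points p (u ++ v) ≡ points p u ++ visited (endpoint p u) v
  points-++ p []      v = points-visited p v
  points-++ p (s ∷ u) v = cong (p ∷_) (points-++ (move p s) u v)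

  visited-++ : ∀ p u v → visited p (u ++ v) ≡ visited p u ++ visited (endpoint p u) v
  visited-++ p []      v = refl
  visited-++ p (s ∷ u) v = points-++ (move p s) u v

  diagonalStarts-++ : ∀ p u v →
    diagonalStarts p (u ++ v) ≡ diagonalStarts p u ++ diagonalStarts (endpoint p u) v
  diagonalStarts-++ p []             v = refl
  diagonalStarts-++ p (east ∷ u)     v = diagonalStarts-++ (move p east) u v
  diagonalStarts-++ p (north ∷ u)    v = diagonalStarts-++ (move p north) u v
  diagonalStarts-++ p (diagonal ∷ u) v = cong (p ∷_) (diagonalStarts-++ (move p diagonal) u v)

  endpoint-++ : ∀ p u v → endpoint p (u ++ v) ≡ endpoint (endpoint p u) v
  endpoint-++ p u v = foldl-++ move p u v

  endpoint-easts : ∀ x y e → endpoint (x , y) (easts e) ≡ (e + x , y)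
  endpoint-easts x y zero    = refl
  endpoint-easts x y (suc e) = trans (endpoint-easts (suc x) y e) (cong (_, y) (+-suc e x))

  diagonalStarts-easts : ∀ p e → diagonalStarts p (easts e) ≡ []
  diagonalStarts-easts p zero    = refl
  diagonalStarts-easts p (suc e) = diagonalStarts-easts (move p east) e

  move-step : ∀ x y b → move (x , y) (step b) ≡ (bit b + x , suc y)
  move-step x y true  = refl
  move-step x y false = refl

  at-endpoint : ∀ {P : Point → Set} p w → All P (points p w) → P (endpoint p w)
  at-endpoint p []      (Pp ∷ _) = Pp
  at-endpoint p (s ∷ w) (_ ∷ Ps) = at-endpoint (move p s) w Ps

  points-easts : ∀ {P : Point → Set} → (∀ {x y} → P (suc x , y) → P (x , y)) →
    ∀ x y e → P (e + x , y) → All P (points (x , y) (easts e))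
  points-easts         down x y zero    P-end = P-end ∷ []
  points-easts {P = P} down x y (suc e) P-end = back (suc e) P-end ∷
    points-easts down (suc x) y e (subst (λ z → P (z , y)) (sym (+-suc e x)) P-end)
    where
    back : ∀ e → P (e + x , y) → P (x , y)
    back zero    q = q
    back (suc e) q = back e (down q)

  points⇒visited : ∀ {P : Point → Set} p w → All P (points p w) → All P (visited p w)
  points⇒visited p w all rewrite points-visited p w = All.tail all

  up : Point → Point
  up (x , y) = x , suc y

  up-move : ∀ p s → move (up p) s ≡ up (move p s)
  up-move p east     = refl
  up-move p north    = refl
  up-move p diagonal = refl

  endpoint-up : ∀ p w → endpoint (up p) w ≡ up (endpoint p w)
  endpoint-up p []      = refl
  endpoint-up p (s ∷ w) = trans (cong (λ q → endpoint q w) (up-move p s)) (endpoint-up (move p s) w)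

  points-up : ∀ p w → points (up p) w ≡ map up (points p w)
  points-up p []      = refl
  points-up p (s ∷ w) = cong (up p ∷_) (trans (cong (λ q → points q w) (up-move p s)) (points-up (move p s) w))

  diagonalStarts-up : ∀ p w → diagonalStarts (up p) w ≡ map up (diagonalStarts p w)
  diagonalStarts-up p []             = refl
  diagonalStarts-up p (east ∷ w)     = diagonalStarts-up (move p east) w
  diagonalStarts-up p (north ∷ w)    = diagonalStarts-up (move p north) w
  diagonalStarts-up p (diagonal ∷ w) = cong (up p ∷_) (diagonalStarts-up (move p diagonal) w)

  -- East runs

  closeRun-++ : ∀ c xs ys → closeRun c xs ++ ys ≡ closeRun c (xs ++ ys)
  closeRun-++ zero    xs ys = refl
  closeRun-++ (suc c) xs ys = refl

  runsFrom-split : ∀ c u b v → runsFrom c (u ++ step b ∷ v) ≡ runsFrom c u ++ runsFrom 0 v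
  runsFrom-split c []             true  v = sym (closeRun-++ c [] _)
  runsFrom-split c []             false v = sym (closeRun-++ c [] _)
  runsFrom-split c (east ∷ u)     b     v = runsFrom-split (suc c) u b v
  runsFrom-split c (north ∷ u)    b     v =
    trans (cong (closeRun c) (runsFrom-split 0 u b v)) (sym (closeRun-++ c (runsFrom 0 u) _))
  runsFrom-split c (diagonal ∷ u) b     v =
    trans (cong (closeRun c) (runsFrom-split 0 u b v)) (sym (closeRun-++ c (runsFrom 0 u) _))

  runsFrom-easts : ∀ c e → runsFrom c (easts e) ≡ closeRun (e + c) []
  runsFrom-easts c zero    = refl
  runsFrom-easts c (suc e) = trans (runsFrom-easts (suc c) e) (cong (λ z → closeRun z []) (+-suc e c))

  eastRuns-easts : ∀ e → eastRuns (easts e) ≡ closeRun e []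
  eastRuns-easts e = trans (runsFrom-easts 0 e) (cong (λ z → closeRun z []) (+-identityʳ e))

  ++-closeRun-↭ : ∀ {xs ys} e → xs ↭ ys → xs ++ closeRun e [] ↭ closeRun e ys
  ++-closeRun-↭ {xs} e xs↭ys = ↭-trans (++-comm xs (closeRun e []))
    (↭-trans (↭-reflexive (closeRun-++ e [] xs)) (closeRun-↭ e xs↭ys))

  eastRuns-thenEasts : ∀ l → eastRuns (word thenEasts l) ↭ nonzeros (runs l)
  eastRuns-thenEasts []            = ↭-refl
  eastRuns-thenEasts ((b , e) ∷ l) = ↭-trans
    (↭-reflexive (begin
      eastRuns (word thenEasts ((b , e) ∷ l))                ≡⟨ cong eastRuns (word-∷ thenEasts (b , e) l) ⟩
      eastRuns (word thenEasts l ++ step b ∷ easts e)        ≡⟨ runsFrom-split 0 (word thenEasts l) b (easts e) ⟩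
      eastRuns (word thenEasts l) ++ eastRuns (easts e)      ≡⟨ cong (eastRuns (word thenEasts l) ++_) (eastRuns-easts e) ⟩
      eastRuns (word thenEasts l) ++ closeRun e []           ∎))
    (++-closeRun-↭ e (eastRuns-thenEasts l))
    where open ≡-Reasoning

  word-eastsThen-++ : ∀ b e l v →
    word eastsThen ((b , e) ∷ l) ++ v ≡ (word eastsThen l ++ easts e) ++ step b ∷ v
  word-eastsThen-++ b e l v = begin
    word eastsThen ((b , e) ∷ l) ++ v                        ≡⟨ cong (_++ v) (word-∷ eastsThen (b , e) l) ⟩
    (word eastsThen l ++ (easts e ++ [ step b ])) ++ v  ≡⟨ ++-assoc (word eastsThen l) _ v ⟩
    word eastsThen l ++ (eastsThen (b , e) ++ v)             ≡⟨ cong (word eastsThen l ++_) (eastsThen-split b e v) ⟩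
    word eastsThen l ++ (easts e ++ step b ∷ v)              ≡⟨ ++-assoc (word eastsThen l) (easts e) _ ⟨
    (word eastsThen l ++ easts e) ++ step b ∷ v              ∎
    where open ≡-Reasoning

  word-eastsThen-∷ : ∀ b e l → word eastsThen ((b , e) ∷ l) ≡ (word eastsThen l ++ easts e) ∷ʳ step b
  word-eastsThen-∷ b e l = trans (sym (++-identityʳ _)) (word-eastsThen-++ b e l [])

  eastRuns-eastsThen-++ : ∀ l v → eastRuns (word eastsThen l ++ v) ≡ eastRuns (word eastsThen l) ++ eastRuns v
  eastRuns-eastsThen-++ []            v = refl
  eastRuns-eastsThen-++ ((b , e) ∷ l) v = begin
    eastRuns (word eastsThen ((b , e) ∷ l) ++ v)                ≡⟨ cong eastRuns (word-eastsThen-++ b e l v) ⟩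
    eastRuns (u ++ step b ∷ v)                                  ≡⟨ runsFrom-split 0 u b v ⟩
    eastRuns u ++ eastRuns v                                    ≡⟨ cong (_++ eastRuns v) (++-identityʳ (eastRuns u)) ⟨
    (eastRuns u ++ []) ++ eastRuns v                            ≡⟨ cong (_++ eastRuns v) (runsFrom-split 0 u b []) ⟨
    eastRuns (u ∷ʳ step b) ++ eastRuns v                        ≡⟨ cong (λ z → eastRuns z ++ eastRuns v) (word-eastsThen-∷ b e l) ⟨
    eastRuns (word eastsThen ((b , e) ∷ l)) ++ eastRuns v       ∎
    where
    open ≡-Reasoning
    u : Path
    u = word eastsThen l ++ easts e

  eastRuns-eastsThen-easts : ∀ l e → eastRuns (word eastsThen l ++ easts e) ↭ closeRun e (nonzeros (runs l))
  eastRuns-eastsThen-easts l e = ↭-trans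
    (↭-reflexive (trans (eastRuns-eastsThen-++ l (easts e)) (cong (eastRuns (word eastsThen l) ++_) (eastRuns-easts e))))
    (++-closeRun-↭ e (whole l))
    where
    whole : ∀ l → eastRuns (word eastsThen l) ↭ nonzeros (runs l)
    whole []             = ↭-refl
    whole ((b , e) ∷ l) = ↭-trans
      (↭-reflexive (trans (cong eastRuns (word-eastsThen-∷ b e l))
        (trans (runsFrom-split 0 (word eastsThen l ++ easts e) b []) (++-identityʳ _))))
      (eastRuns-eastsThen-easts l e)

  -- Positions of the letters of a word

  endpoint-thenEasts : ∀ l → endpoint origin (word thenEasts l) ≡ (W l , length l)
  move-thenEasts : ∀ b l → move (endpoint origin (word thenEasts l)) (step b) ≡ (bit b + W l , suc (length l))

  endpoint-thenEasts []            = refl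
  endpoint-thenEasts ((b , e) ∷ l) = begin
    endpoint origin (word thenEasts ((b , e) ∷ l))
      ≡⟨ cong (endpoint origin) (word-∷ thenEasts (b , e) l) ⟩
    endpoint origin (word thenEasts l ++ thenEasts (b , e))
      ≡⟨ endpoint-++ origin (word thenEasts l) (thenEasts (b , e)) ⟩
    endpoint (move (endpoint origin (word thenEasts l)) (step b)) (easts e)
      ≡⟨ cong (λ q → endpoint q (easts e)) (move-thenEasts b l) ⟩
    endpoint (bit b + W l , suc (length l)) (easts e)
      ≡⟨ endpoint-easts (bit b + W l) (suc (length l)) e ⟩
    (e + (bit b + W l) , suc (length l))
      ≡⟨ cong (_, suc (length l)) (solve 3 (λ e b w → e :+ (b :+ w) := b :+ e :+ w) refl e (bit b) (W l)) ⟩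
    (W ((b , e) ∷ l) , suc (length l)) ∎
    where
    open ≡-Reasoning
    open +-*-Solver

  move-thenEasts b l = trans (cong (λ q → move q (step b)) (endpoint-thenEasts l)) (move-step (W l) (length l) b)

  endpoint-eastsThen-easts : ∀ l e → endpoint origin (word eastsThen l ++ easts e) ≡ (e + W l , length l)
  endpoint-eastsThen : ∀ l → endpoint origin (word eastsThen l) ≡ (W l , length l)
  move-eastsThen : ∀ b e l →
    move (endpoint origin (word eastsThen l ++ easts e)) (step b) ≡ (W ((b , e) ∷ l) , suc (length l))

  endpoint-eastsThen-easts l e = trans (endpoint-++ origin (word eastsThen l) (easts e))
    (trans (cong (λ q → endpoint q (easts e)) (endpoint-eastsThen l)) (endpoint-easts (W l) (length l) e))

  endpoint-eastsThen []            = refl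
  endpoint-eastsThen ((b , e) ∷ l) = trans (cong (endpoint origin) (word-eastsThen-∷ b e l))
    (trans (endpoint-++ origin (word eastsThen l ++ easts e) [ step b ]) (move-eastsThen b e l))

  move-eastsThen b e l = trans (cong (λ q → move q (step b)) (endpoint-eastsThen-easts l e))
    (trans (move-step (e + W l) (length l) b) (cong (_, suc (length l)) (sym (+-assoc (bit b) e (W l)))))

  ifDiagonal : Bool → Point → List Point
  ifDiagonal b p = if b then [ p ] else []

  All-ifDiagonal⁺ : ∀ {P : Point → Set} b {p} → (b ≡ true → P p) → All P (ifDiagonal b p)
  All-ifDiagonal⁺ true  f = f refl ∷ []
  All-ifDiagonal⁺ false f = []

  All-ifDiagonal⁻ : ∀ {P : Point → Set} b {p} → All P (ifDiagonal b p) → b ≡ true → P p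
  All-ifDiagonal⁻ true (Pp ∷ _) _ = Pp

  diagonalStarts-step : ∀ p b w → diagonalStarts p (step b ∷ w) ≡ ifDiagonal b p ++ diagonalStarts (move p (step b)) w
  diagonalStarts-step p true  w = refl
  diagonalStarts-step p false w = refl

  diagonalStarts-thenEasts : ∀ b e l → diagonalStarts origin (word thenEasts ((b , e) ∷ l)) ≡
    diagonalStarts origin (word thenEasts l) ++ ifDiagonal b (W l , length l)
  diagonalStarts-thenEasts b e l = begin
    diagonalStarts origin (word thenEasts ((b , e) ∷ l))
      ≡⟨ cong (diagonalStarts origin) (word-∷ thenEasts (b , e) l) ⟩
    diagonalStarts origin (word thenEasts l ++ step b ∷ easts e)
      ≡⟨ diagonalStarts-++ origin (word thenEasts l) (step b ∷ easts e) ⟩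
    ds ++ diagonalStarts (endpoint origin (word thenEasts l)) (step b ∷ easts e)
      ≡⟨ cong (λ q → ds ++ diagonalStarts q (step b ∷ easts e)) (endpoint-thenEasts l) ⟩
    ds ++ diagonalStarts (W l , length l) (step b ∷ easts e)
      ≡⟨ cong (ds ++_) (diagonalStarts-step (W l , length l) b (easts e)) ⟩
    ds ++ (ifDiagonal b (W l , length l) ++ diagonalStarts (move (W l , length l) (step b)) (easts e))
      ≡⟨ cong (λ z → ds ++ (ifDiagonal b (W l , length l) ++ z)) (diagonalStarts-easts _ e) ⟩
    ds ++ (ifDiagonal b (W l , length l) ++ [])
      ≡⟨ cong (ds ++_) (++-identityʳ (ifDiagonal b (W l , length l))) ⟩
    ds ++ ifDiagonal b (W l , length l) ∎
    where
    open ≡-Reasoning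
    ds : List Point
    ds = diagonalStarts origin (word thenEasts l)

  diagonalStarts-eastsThen-easts : ∀ l e →
    diagonalStarts origin (word eastsThen l ++ easts e) ≡ diagonalStarts origin (word eastsThen l)
  diagonalStarts-eastsThen-easts l e = trans (diagonalStarts-++ origin (word eastsThen l) (easts e))
    (trans (cong (diagonalStarts origin (word eastsThen l) ++_) (diagonalStarts-easts _ e)) (++-identityʳ _))

  diagonalStarts-eastsThen : ∀ b e l → diagonalStarts origin (word eastsThen ((b , e) ∷ l)) ≡
    diagonalStarts origin (word eastsThen l) ++ ifDiagonal b (e + W l , length l)
  diagonalStarts-eastsThen b e l = begin
    diagonalStarts origin (word eastsThen ((b , e) ∷ l))
      ≡⟨ cong (diagonalStarts origin) (word-eastsThen-∷ b e l) ⟩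
    diagonalStarts origin ((word eastsThen l ++ easts e) ∷ʳ step b)
      ≡⟨ diagonalStarts-++ origin (word eastsThen l ++ easts e) [ step b ] ⟩
    diagonalStarts origin (word eastsThen l ++ easts e)
      ++ diagonalStarts (endpoint origin (word eastsThen l ++ easts e)) [ step b ]
      ≡⟨ cong₂ _++_ (diagonalStarts-eastsThen-easts l e)
           (cong (λ q → diagonalStarts q [ step b ]) (endpoint-eastsThen-easts l e)) ⟩
    diagonalStarts origin (word eastsThen l) ++ diagonalStarts (e + W l , length l) [ step b ]
      ≡⟨ cong (diagonalStarts origin (word eastsThen l) ++_)
           (trans (diagonalStarts-step (e + W l , length l) b []) (++-identityʳ _)) ⟩
    diagonalStarts origin (word eastsThen l) ++ ifDiagonal b (e + W l , length l) ∎
    where open ≡-Reasoning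

  Allowed : (ℕ → Bool) → List Letter → Set
  Allowed f []            = ⊤
  Allowed f ((b , _) ∷ l) = (b ≡ true → f (length l) ≡ true) × Allowed f l

  StartsIn : (ℕ → Bool) → Point → Set
  StartsIn f p = f (proj₂ p) ≡ true

  allowed-thenEasts⁻ : ∀ f l → All (StartsIn f) (diagonalStarts origin (word thenEasts l)) → Allowed f l
  allowed-thenEasts⁻ f []            _ = tt
  allowed-thenEasts⁻ f ((b , e) ∷ l) q
    with q₁ , q₂ ← All.++⁻ (diagonalStarts origin (word thenEasts l)) (subst (All _) (diagonalStarts-thenEasts b e l) q)
    = All-ifDiagonal⁻ b q₂ , allowed-thenEasts⁻ f l q₁

  allowed-thenEasts⁺ : ∀ f l → Allowed f l → All (StartsIn f) (diagonalStarts origin (word thenEasts l))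
  allowed-thenEasts⁺ f []            _         = []
  allowed-thenEasts⁺ f ((b , e) ∷ l) (q₁ , q₂) = subst (All _) (sym (diagonalStarts-thenEasts b e l))
    (All.++⁺ (allowed-thenEasts⁺ f l q₂) (All-ifDiagonal⁺ b q₁))

  allowed-eastsThen⁻ : ∀ f l → All (StartsIn f) (diagonalStarts origin (word eastsThen l)) → Allowed f l
  allowed-eastsThen⁻ f []            _ = tt
  allowed-eastsThen⁻ f ((b , e) ∷ l) q
    with q₁ , q₂ ← All.++⁻ (diagonalStarts origin (word eastsThen l)) (subst (All _) (diagonalStarts-eastsThen b e l) q)
    = All-ifDiagonal⁻ b q₂ , allowed-eastsThen⁻ f l q₁

  allowed-eastsThen⁺ : ∀ f l → Allowed f l → All (StartsIn f) (diagonalStarts origin (word eastsThen l))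
  allowed-eastsThen⁺ f []            _         = []
  allowed-eastsThen⁺ f ((b , e) ∷ l) (q₁ , q₂) = subst (All _) (sym (diagonalStarts-eastsThen b e l))
    (All.++⁺ (allowed-eastsThen⁺ f l q₂) (All-ifDiagonal⁺ b q₁))

  module _ (k : ℕ) where

    StrictlyAbove : Point → Set
    StrictlyAbove (x , y) = k * x < y

    visited-thenEasts : ∀ b e l → visited origin (word thenEasts ((b , e) ∷ l)) ≡
      visited origin (word thenEasts l) ++ points (bit b + W l , suc (length l)) (easts e)
    visited-thenEasts b e l = trans (cong (visited origin) (word-∷ thenEasts (b , e) l))
      (trans (visited-++ origin (word thenEasts l) (thenEasts (b , e)))
        (cong (λ q → visited origin (word thenEasts l) ++ points q (easts e)) (move-thenEasts b l)))

    end-x : ∀ b e l → e + (bit b + W l) ≡ W ((b , e) ∷ l)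
    end-x b e l = solve 3 (λ e b w → e :+ (b :+ w) := b :+ e :+ w) refl e (bit b) (W l)
      where open +-*-Solver

    below-thenEasts⁻ : ∀ l → All StrictlyAbove (visited origin (word thenEasts l)) → Below k l
    below-thenEasts⁻ []            _ = tt
    below-thenEasts⁻ ((b , e) ∷ l) q
      with q₁ , q₂ ← All.++⁻ (visited origin (word thenEasts l)) (subst (All _) (visited-thenEasts b e l) q)
      = subst StrictlyAbove
          (trans (endpoint-easts (bit b + W l) (suc (length l)) e) (cong (_, suc (length l)) (end-x b e l)))
          (at-endpoint _ (easts e) q₂)
      , below-thenEasts⁻ l q₁

    below-thenEasts⁺ : ∀ l → Below k l → All StrictlyAbove (visited origin (word thenEasts l))
    below-thenEasts⁺ []            _         = []
    below-thenEasts⁺ ((b , e) ∷ l) (q₁ , q₂) = subst (All _) (sym (visited-thenEasts b e l))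
      (All.++⁺ (below-thenEasts⁺ l q₂)
        (points-easts (λ {x} → ≤-<-trans (*-monoʳ-≤ k (n≤1+n x))) (bit b + W l) (suc (length l)) e
          (subst (λ x → k * x < suc (length l)) (sym (end-x b e l)) q₁)))

    points-eastsThen-easts : ∀ l e → points origin (word eastsThen l ++ easts e) ≡
      points origin (word eastsThen l) ++ visited (W l , length l) (easts e)
    points-eastsThen-easts l e = trans (points-++ origin (word eastsThen l) (easts e))
      (cong (λ q → points origin (word eastsThen l) ++ visited q (easts e)) (endpoint-eastsThen l))

    points-eastsThen : ∀ b e l → points origin (word eastsThen ((b , e) ∷ l)) ≡
      points origin (word eastsThen l ++ easts e) ∷ʳ (W ((b , e) ∷ l) , suc (length l))
    points-eastsThen b e l = trans (cong (points origin) (word-eastsThen-∷ b e l))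
      (trans (points-++ origin (word eastsThen l ++ easts e) [ step b ])
        (cong (λ q → points origin (word eastsThen l ++ easts e) ∷ʳ q) (move-eastsThen b e l)))

    EndsOff TouchesNowhere : Point → Set
    EndsOff p        = ¬ OnLine k (move p diagonal)
    TouchesNowhere p = ¬ OnLine k p × ¬ OnLine k (move p diagonal)

    above-easts⁺ : ∀ l e → All (WeaklyAbove k) (points origin (word eastsThen l)) → k * (e + W l) ≤ length l →
      All (WeaklyAbove k) (points origin (word eastsThen l ++ easts e))
    above-easts⁺ l e q le = subst (All _) (sym (points-eastsThen-easts l e))
      (All.++⁺ q (points⇒visited _ (easts e)
        (points-easts (λ {x} → ≤-trans (*-monoʳ-≤ k (n≤1+n x))) (W l) (length l) e le)))

    above-easts⁻ : ∀ l e → All (WeaklyAbove k) (points origin (word eastsThen l ++ easts e)) →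
      All (WeaklyAbove k) (points origin (word eastsThen l))
    above-easts⁻ l e q = All.++⁻ˡ (points origin (word eastsThen l)) (subst (All _) (points-eastsThen-easts l e) q)

    below-eastsThen⁻ : ∀ l → All (WeaklyAbove k) (points origin (word eastsThen l)) →
      All EndsOff (diagonalStarts origin (word eastsThen l)) → Below k l
    below-eastsThen⁻ []            _ _ = tt
    below-eastsThen⁻ ((b , e) ∷ l) q t
      with q₁ , q₂ ∷ [] ← All.++⁻ (points origin (word eastsThen l ++ easts e)) (subst (All _) (points-eastsThen b e l) q)
      with t₁ , t₂ ← All.++⁻ (diagonalStarts origin (word eastsThen l)) (subst (All _) (diagonalStarts-eastsThen b e l) t)
      = last-step b q₂ (All-ifDiagonal⁻ b t₂) , below-eastsThen⁻ l (above-easts⁻ l e q₁) t₁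
      where
      last-step : ∀ b → k * W ((b , e) ∷ l) ≤ suc (length l) → (b ≡ true → EndsOff (e + W l , length l)) →
        k * W ((b , e) ∷ l) < suc (length l)
      last-step false _  _   = s≤s (subst (WeaklyAbove k) (endpoint-eastsThen-easts l e)
        (at-endpoint origin (word eastsThen l ++ easts e) q₁))
      last-step true  le off = ≤∧≢⇒< le (off refl ∘ sym)

    below-eastsThen⁺ : .{{_ : NonZero k}} → ∀ l → Below k l →
      All (WeaklyAbove k) (points origin (word eastsThen l)) ×
      All TouchesNowhere (diagonalStarts origin (word eastsThen l))
    below-eastsThen⁺ []            _         = ≤-reflexive (*-zeroʳ k) ∷ [] , []
    below-eastsThen⁺ ((b , e) ∷ l) (q₁ , q₂) with p , t ← below-eastsThen⁺ l q₂ =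
      subst (All _) (sym (points-eastsThen b e l))
        (All.++⁺ (above-easts⁺ l e p (≤-trans (*-monoʳ-≤ k e+W≤) (s≤s⁻¹ q₁))) (<⇒≤ q₁ ∷ [])) ,
      subst (All _) (sym (diagonalStarts-eastsThen b e l))
        (All.++⁺ t (All-ifDiagonal⁺ b touch))
      where
      e+W≤ : e + W l ≤ W ((b , e) ∷ l)
      e+W≤ = ≤-trans (m≤n+m (e + W l) (bit b)) (≤-reflexive (sym (+-assoc (bit b) e (W l))))
      touch : b ≡ true → TouchesNowhere (e + W l , length l)
      touch refl = (λ eq → <-irrefl (sym eq) (<-≤-trans (*-monoʳ-< k (n<1+n (e + W l))) (s≤s⁻¹ q₁)))
                 , (λ eq → <-irrefl (sym eq) q₁)

  -- Membership in the alphabets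

  All-≤-sum : ∀ es → All (_≤ sum es) es
  All-≤-sum []       = []
  All-≤-sum (e ∷ es) = m≤m+n e _ ∷ All.map (λ le → ≤-trans le (m≤n+m _ e)) (All-≤-sum es)

  ∈-steps⁺ : ∀ {b} c → (b ≡ true → c ≡ true) → b ∈ steps c
  ∈-steps⁺ {false} true  _ = here refl
  ∈-steps⁺ {true}  true  _ = there (here refl)
  ∈-steps⁺ {false} false _ = here refl
  ∈-steps⁺ {true}  false f with () ← f refl

  ∈-steps⁻ : ∀ {b} c → b ∈ steps c → b ≡ true → c ≡ true
  ∈-steps⁻ true  _          _    = refl
  ∈-steps⁻ false (here refl) ()

  Unique-steps : ∀ c → Unique (steps c)
  Unique-steps true  = ((λ ()) ∷ []) ∷ [] ∷ []
  Unique-steps false = [] ∷ []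

  Unique-choices : ∀ {As : List (List A)} → All Unique As → Unique (choices As)
  Unique-choices []       = [] ∷ []
  Unique-choices (u ∷ us) = Unique.cartesianProductWith⁺ _∷_ ∷-injective u (Unique-choices us)

  module _ (B : ℕ) (f : ℕ → Bool) where

    private
      letters : Bool → List Letter
      letters b = cartesianProduct (steps b) (upTo (suc B))

    ∈-words⁺ : ∀ l → Allowed f l → All (_≤ B) (runs l) → l ∈ choices (map letters (applyDownFrom f (length l)))
    ∈-words⁺ []            _         _          = here refl
    ∈-words⁺ ((b , e) ∷ l) (p , ps) (le ∷ les) = ∈-cartesianProductWith⁺ _∷_
      (∈-cartesianProduct⁺ (∈-steps⁺ (f (length l)) p) (∈-upTo⁺ (s≤s le))) (∈-words⁺ l ps les)

    ∈-words⁻ : ∀ m {l} → l ∈ choices (map letters (applyDownFrom f m)) → length l ≡ m × Allowed f l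
    ∈-words⁻ zero    (here refl) = refl , tt
    ∈-words⁻ (suc m) l∈
      with (b , e) , l , x∈ , l∈ , refl ← ∈-cartesianProductWith⁻ _∷_ (letters (f m)) (choices (map letters (applyDownFrom f m))) l∈
      with refl , ps ← ∈-words⁻ m l∈
      = refl , ∈-steps⁻ (f m) (proj₁ (∈-cartesianProduct⁻ (steps (f m)) (upTo (suc B)) x∈)) , ps

  -- Residues of diagonal steps

  member : ∀ {k} → Subset k → ℕ → Bool
  member []      _       = false
  member (b ∷ S) zero    = b
  member (b ∷ S) (suc i) = member S i

  member⁺ : ∀ {k} {S : Subset k} {i} → i ∈ˢ S → member S (toℕ i) ≡ true
  member⁺ {S = _ ∷ _} Vec.here       = refl
  member⁺ {S = _ ∷ _} (Vec.there i∈) = member⁺ i∈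

  member⁻ : ∀ {k} (S : Subset k) m → member S m ≡ true → ∃[ i ] (i ∈ˢ S × toℕ i ≡ m)
  member⁻ (true ∷ S) zero    _  = Fin.zero , Vec.here , refl
  member⁻ (b ∷ S)    (suc m) eq with i , i∈ , refl ← member⁻ S m eq = Fin.suc i , Vec.there i∈ , refl

  ∑-applyDownFrom-suc : ∀ f m → ∑ (applyDownFrom f (suc m)) bit ≡ ∑ (applyDownFrom (f ∘ suc) m) bit + bit (f 0)
  ∑-applyDownFrom-suc f zero    = +-identityʳ _
  ∑-applyDownFrom-suc f (suc m) = trans (cong (bit (f (suc m)) +_) (∑-applyDownFrom-suc f m)) (sym (+-assoc (bit (f (suc m))) _ _))

  ∑-member : ∀ {k} (S : Subset k) → ∑ (applyDownFrom (member S) k) bit ≡ ∣ S ∣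
  ∑-member []          = refl
  ∑-member {suc k} (b ∷ S) = trans (∑-applyDownFrom-suc (member (b ∷ S)) k)
    (trans (cong (_+ bit b) (∑-member S)) (add b))
    where
    add : ∀ b → ∣ S ∣ + bit b ≡ ∣ b ∷ S ∣
    add true  = +-comm ∣ S ∣ 1
    add false = +-identityʳ ∣ S ∣

  module Residues (k : ℕ) .{{_ : NonZero k}} (S : Subset k) where

    startAt : ℕ → Bool
    startAt y = member S (y % k)

    -- Height 0 is treated like height k, which makes endAt periodic.
    endAt : ℕ → Bool
    endAt zero    = startAt (pred k)
    endAt (suc y) = startAt y

    startAt-periodic : ∀ i → startAt (i + k) ≡ startAt i
    startAt-periodic i = cong (member S) ([m+n]%n≡m%n i k)

    endAt-periodic : ∀ i → endAt (i + k) ≡ endAt i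
    endAt-periodic zero    = cong endAt (sym (suc-pred k))
    endAt-periodic (suc i) = startAt-periodic i

    startAt⁺ : ∀ x y → AllowedDiagonal S (x , y) → startAt y ≡ true
    startAt⁺ x y (j , r , (i , i∈ , refl) , eq) = trans (cong (member S) residue) (member⁺ i∈)
      where
      open ≡-Reasoning
      residue : y % k ≡ toℕ i
      residue = begin
        y % k                ≡⟨ cong (_% k) (suc-injective (trans eq (+-suc (k * j) (toℕ i)))) ⟩
        (k * j + toℕ i) % k  ≡⟨ cong (_% k) (trans (+-comm (k * j) (toℕ i)) (cong (toℕ i +_) (*-comm k j))) ⟩
        (toℕ i + j * k) % k  ≡⟨ [m+kn]%n≡m%n (toℕ i) j k ⟩
        toℕ i % k            ≡⟨ m<n⇒m%n≡m (Fin.toℕ<n i) ⟩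
        toℕ i                ∎

    startAt⁻ : ∀ x y → startAt y ≡ true → AllowedDiagonal S (x , y)
    startAt⁻ x y eq with i , i∈ , i≡ ← member⁻ S (y % k) eq = y / k , suc (toℕ i) , (i , i∈ , refl) , (begin
      suc y                        ≡⟨ cong suc (m≡m%n+[m/n]*n y k) ⟩
      suc (y % k + y / k * k)      ≡⟨ cong₂ (λ a b → suc (a + b)) (sym i≡) (*-comm (y / k) k) ⟩
      suc (toℕ i + k * (y / k))    ≡⟨ +-comm (suc (toℕ i)) (k * (y / k)) ⟩
      k * (y / k) + suc (toℕ i)    ∎)
      where open ≡-Reasoning

    startAt-pred⁺ : k ∈₁ S → startAt (pred k) ≡ true
    startAt-pred⁺ (i , i∈ , eq) = trans (cong (member S)
      (trans (cong (λ z → pred z % k) (sym eq)) (m<n⇒m%n≡m (Fin.toℕ<n i)))) (member⁺ i∈)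

    startAt-pred⁻ : startAt (pred k) ≡ true → k ∈₁ S
    startAt-pred⁻ eq with i , i∈ , i≡ ← member⁻ S (pred k % k) eq = i , i∈ , (begin
      suc (toℕ i)       ≡⟨ cong suc i≡ ⟩
      suc (pred k % k)  ≡⟨ cong suc (m<n⇒m%n≡m (≤-reflexive (suc-pred k))) ⟩
      suc (pred k)      ≡⟨ suc-pred k ⟩
      k                 ∎)
      where open ≡-Reasoning

    endsOnLine⇒k∈S : ∀ p → AllowedDiagonal S p → OnLine k (move p diagonal) → k ∈₁ S
    endsOnLine⇒k∈S (x , y) ok on = startAt-pred⁻ (trans (sym shifted) (startAt⁺ x y ok))
      where
      open ≡-Reasoning
      y≡ : y ≡ pred k + x * k
      y≡ = suc-injective (begin
        suc y                   ≡⟨ on ⟩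
        k * suc x               ≡⟨ *-comm k (suc x) ⟩
        k + x * k               ≡⟨ cong (_+ x * k) (suc-pred k) ⟨
        suc (pred k) + x * k    ∎)
      shifted : startAt y ≡ startAt (pred k)
      shifted = trans (cong startAt y≡) (periodic-* {f = startAt} startAt-periodic x (pred k))

    ∑-startAt : ∀ n → ∑ (applyDownFrom startAt (n * k)) bit ≡ ∣ S ∣ * n
    ∑-startAt n = begin
      ∑ (applyDownFrom startAt (n * k)) bit       ≡⟨ cong (λ bs → ∑ bs bit) (applyDownFrom-periodic startAt-periodic n) ⟩
      ∑ (pow n (applyDownFrom startAt k)) bit     ≡⟨ ∑-pow n (applyDownFrom startAt k) bit ⟩
      n * ∑ (applyDownFrom startAt k) bit         ≡⟨ cong (λ bs → n * ∑ bs bit)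
                                                       (applyDownFrom-cong-< k (λ i i<k → cong (member S) (m<n⇒m%n≡m i<k))) ⟩
      n * ∑ (applyDownFrom (member S) k) bit      ≡⟨ cong (n *_) (∑-member S) ⟩
      n * ∣ S ∣                                   ≡⟨ *-comm n ∣ S ∣ ⟩
      ∣ S ∣ * n                                   ∎
      where open ≡-Reasoning

    endAt-multiple : k ∈₁ S → ∀ n → endAt (n * k) ≡ true
    endAt-multiple k∈ n = trans (periodic-* {f = endAt} endAt-periodic n 0) (startAt-pred⁺ k∈)

    ∑-endAt : k ∈₁ S → ∀ n → ∑ (applyDownFrom endAt (n * k)) bit ≡ ∣ S ∣ * n
    ∑-endAt k∈ n = suc-injective (begin
      suc (∑ (applyDownFrom endAt (n * k)) bit)
        ≡⟨ cong (λ b → bit b + ∑ (applyDownFrom endAt (n * k)) bit) (endAt-multiple k∈ n) ⟨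
      ∑ (applyDownFrom endAt (suc (n * k))) bit
        ≡⟨ ∑-applyDownFrom-suc endAt (n * k) ⟩
      ∑ (applyDownFrom startAt (n * k)) bit + bit (startAt (pred k))
        ≡⟨ cong₂ (λ s b → s + bit b) (∑-startAt n) (startAt-pred⁺ k∈) ⟩
      ∣ S ∣ * n + 1
        ≡⟨ +-comm (∣ S ∣ * n) 1 ⟩
      suc (∣ S ∣ * n) ∎)
      where open ≡-Reasoning

  _≟ˢ_ : (s t : Step) → Dec (s ≡ t)
  east     ≟ˢ east     = yes refl
  east     ≟ˢ north    = no λ ()
  east     ≟ˢ diagonal = no λ ()
  north    ≟ˢ east     = no λ ()
  north    ≟ˢ north    = yes refl
  north    ≟ˢ diagonal = no λ ()
  diagonal ≟ˢ east     = no λ ()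
  diagonal ≟ˢ north    = no λ ()
  diagonal ≟ˢ diagonal = yes refl

  concatMap-reverse : ∀ g l → word g (reverse l) ≡ concatMap g l
  concatMap-reverse g l = cong (concatMap g) (reverse-involutive l)

  encode-eastsThen : ∀ w → ∃[ e ] ∃[ l ]
    (w ++ [ north ] ≡ word eastsThen ((false , e) ∷ l) × w ≡ word eastsThen l ++ easts e)
  encode-eastsThen w with b , e , ls , eq ← parse-eastsThen w =
    top (reverse ((b , e) ∷ ls)) (trans eq (sym (concatMap-reverse eastsThen ((b , e) ∷ ls))))
    where
    top : ∀ l → w ∷ʳ north ≡ word eastsThen l → ∃[ e ] ∃[ l ]
      (w ∷ʳ north ≡ word eastsThen ((false , e) ∷ l) × w ≡ word eastsThen l ++ easts e)
    top []            eq = ⊥-elim (nonempty w eq)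
      where
      nonempty : ∀ w → w ∷ʳ north ≢ []
      nonempty []      ()
      nonempty (_ ∷ _) ()
    top ((b , e) ∷ l) eq with ∷ʳ-injective w _ (trans eq (word-eastsThen-∷ b e l))
    top ((false , e) ∷ l) eq | w≡ , _  = e , l , eq , w≡
    top ((true , e) ∷ l)  eq | _  , ()

  encode-thenEasts : ∀ w → ∃[ h ] ∃[ l ] north ∷ w ≡ word thenEasts (h ∷ l)
  encode-thenEasts w with e , ls , eq ← parse-thenEasts false w =
    top (reverse ((false , e) ∷ ls)) (trans eq (sym (concatMap-reverse thenEasts ((false , e) ∷ ls))))
    where
    top : ∀ l → north ∷ w ≡ word thenEasts l → ∃[ h ] ∃[ l ] north ∷ w ≡ word thenEasts (h ∷ l)
    top (h ∷ l) eq = h , l , eq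

  -- The bottom letter of a word satisfying Below is (north, 0).
  decode-thenEasts : ∀ k h l → Below k (h ∷ l) → .{{_ : NonZero k}} → ∃[ w ] north ∷ w ≡ word thenEasts (h ∷ l)
  decode-thenEasts k h l bel = bottom (reverse (h ∷ l)) (sym (reverse-involutive (h ∷ l)))
    where
    bottom : ∀ ls → h ∷ l ≡ reverse ls → ∃[ w ] north ∷ w ≡ concatMap thenEasts ls
    bottom []                 ()
    bottom ((false , e) ∷ ls) eq = easts e ++ concatMap thenEasts ls , refl
    bottom ((true , e) ∷ ls)  eq = ⊥-elim (<⇒≱ (proj₁ only-bottom) (≤-trans (>-nonZero⁻¹ k) (m≤m*n k _)))
      where
      only-bottom : Below k ((true , e) ∷ [])
      only-bottom = Below-++⁻ k (reverse ls) (subst (Below k) (trans eq (unfold-reverse (true , e) ls)) bel)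

  last-++-∷ : ∀ {A : Set} (u : List A) x v → last (u ++ x ∷ v) ≡ last (x ∷ v)
  last-++-∷ []          x v = refl
  last-++-∷ (y ∷ [])    x v = refl
  last-++-∷ (y ∷ z ∷ u) x v = last-++-∷ (z ∷ u) x v

  last-thenEasts⁻ : ∀ b e → last (step b ∷ easts e) ≡ just diagonal → (b , e) ≡ (true , 0)
  last-thenEasts⁻ true  zero          _  = refl
  last-thenEasts⁻ b     (suc zero)    ()
  last-thenEasts⁻ b     (suc (suc e)) eq = ⊥-elim (easts-last e eq)
    where
    easts-last : ∀ e → last (east ∷ easts e) ≢ just diagonal
    easts-last zero    ()
    easts-last (suc e) = easts-last e

  last-north⁺ : ∀ w → EndsInDiagonal w → EndsInDiagonal (north ∷ w)
  last-north⁺ (s ∷ w) eq = eq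

  last-north⁻ : ∀ w → EndsInDiagonal (north ∷ w) → EndsInDiagonal w
  last-north⁻ (s ∷ w) eq = eq

  module Encoding (k n : ℕ) .{{_ : NonZero k}} (S : Subset k) (lam : Partition) where

    p : List ℕ
    p = parts lam

    open Counting k n (sum p) p public
    open Rearrangements (sum p) using (E; InRange) public
    open Residues k S public

    inRange : All InRange p
    inRange = All.zip (positive lam , All-≤-sum p)

    runs-bounded : ∀ l → HasRuns l → All (_≤ sum p) (runs l)
    runs-bounded l has = subst (λ m → All (_≤ m) (runs l)) (trans (sym (sum-nonzeros (runs l))) (sum-↭ has)) (All-≤-sum (runs l))

    balanced : ∀ l → W l ≡ n → HasRuns l → Balanced l
    balanced l eq has = trans (cong (λ z → diagonalCount l + z) (trans (sym (sum-↭ has)) (sum-nonzeros (runs l))))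
      (trans (sym (weight-split l)) eq)

    module Candidates (f : ℕ → Bool) (heads : List Letter) where

      allWords : List (List Letter)
      allWords = choices (heads ∷ map letters (applyDownFrom f (n * k)))

      candidates : List (List Letter)
      candidates = filter good? allWords

      length-candidates : length candidates ≡
        ∑ heads (λ h → ∑ (choices (map letters (applyDownFrom f (n * k)))) (λ l → ⟦ good? (h ∷ l) ⟧))
      length-candidates = trans (length-filter-∑ good? allWords) (∑-choices-∷ heads (map letters (applyDownFrom f (n * k))) _)

      Unique-candidates : Unique heads → Unique candidates
      Unique-candidates u = Unique.filter⁺ good? (Unique-choices (u ∷ All.map⁺ (All.universal
        (λ b → Unique.cartesianProduct⁺ (Unique-steps b) (Unique.upTo⁺ (suc (sum p)))) (applyDownFrom f (n * k)))))

      candidates⁺ : ∀ h l → h ∈ heads → length l ≡ n * k → Allowed f l → Good (h ∷ l) → h ∷ l ∈ candidates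
      candidates⁺ h l h∈ len ok good@(_ , _ , has) = ∈-filter⁺ good? (∈-cartesianProductWith⁺ _∷_ h∈
        (subst (λ m → l ∈ choices (map letters (applyDownFrom f m))) len
          (∈-words⁺ (sum p) f l ok (All.tail (runs-bounded (h ∷ l) has))))) good

      candidates⁻ : ∀ {l} → l ∈ candidates → ∃[ h ] ∃[ l′ ]
        (l ≡ h ∷ l′ × h ∈ heads × length l′ ≡ n * k × Allowed f l′ × Good l)
      candidates⁻ l∈
        with l∈ , good ← ∈-filter⁻ good? {xs = allWords} l∈
        with h , l′ , h∈ , l′∈ , refl ← ∈-cartesianProductWith⁻ _∷_ heads (choices (map letters (applyDownFrom f (n * k)))) l∈
        with len , ok ← ∈-words⁻ (sum p) f (n * k) l′∈
        = h , l′ , refl , h∈ , len , ok , good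

    Below-∷ : ∀ h l → length l ≡ n * k → W (h ∷ l) ≡ n → Below k l → Below k (h ∷ l)
    Below-∷ h l len eq bel = s≤s (≤-reflexive (trans (cong (k *_) eq) (trans (*-comm k n) (sym len)))) , bel

    -- Small paths: the letter of a level is the east run on it and the step leaving it;
    -- a final north step completes the top letter.

    northHeads : List Letter
    northHeads = cartesianProduct (false ∷ []) E

    open Candidates startAt northHeads using () renaming (candidates to smallCandidates) public

    small↔ : ∀ {P : Path → Set} →
      (∀ {w} → P w → Large k S n w × HasType lam w × All (EndsOff k) (diagonalStarts origin w)) →
      (∀ {w} → Small k S n w → HasType lam w → P w) →
      Refinement Path P ↔ Fin (length smallCandidates)
    small↔ {P} P⇒ ⇒P = refinement↔Fin (λ w l → w ++ [ north ] ≡ word eastsThen l) smallCandidates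
      (Unique-candidates (Unique.cartesianProduct⁺ {xs = false ∷ []} ([] ∷ []) (Unique.upTo⁺ (suc (sum p)))))
      (λ w l → ≡-dec _≟ˢ_ (w ++ [ north ]) (word eastsThen l))
      (λ {w} {w′} eq eq′ → ∷ʳ-injectiveˡ w w′ (trans eq (sym eq′)))
      (λ eq eq′ → word-injective concatMap-eastsThen-injective (trans (sym eq) eq′))
      encode decode
      where
      open Candidates startAt northHeads

      encode : ∀ {w} → P w → ∃[ l ] (l ∈ smallCandidates × w ++ [ north ] ≡ word eastsThen l)
      encode {w} Pw with e , l , eq , refl ← encode-eastsThen w =
        (false , e) ∷ l ,
        candidates⁺ (false , e) l
          (∈-cartesianProduct⁺ {xs = false ∷ []} (here refl) (∈-upTo⁺ (s≤s (All.head (runs-bounded ((false , e) ∷ l) has)))))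
          len ok (Below-∷ (false , e) l len weight bel , balanced ((false , e) ∷ l) weight has , has) ,
        eq
        where
        large = proj₁ (P⇒ Pw)
        open Large large
        off : All (EndsOff k) (diagonalStarts origin (word eastsThen l))
        off = subst (All _) (diagonalStarts-eastsThen-easts l e) (proj₂ (proj₂ (P⇒ Pw)))
        has : HasRuns ((false , e) ∷ l)
        has = ↭-trans (↭-sym (eastRuns-eastsThen-easts l e)) (proj₁ (proj₂ (P⇒ Pw)))
        end : (e + W l , length l) ≡ (n , k * n)
        end = trans (sym (endpoint-eastsThen-easts l e)) ends
        weight : e + W l ≡ n
        weight = cong proj₁ end
        len : length l ≡ n * k
        len = trans (cong proj₂ end) (*-comm k n)
        ok : Allowed startAt l
        ok = allowed-eastsThen⁻ startAt l (All.map (λ {(x , y)} → startAt⁺ x y)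
          (subst (All _) (diagonalStarts-eastsThen-easts l e) diagonals))
        bel : Below k l
        bel = below-eastsThen⁻ k l (above-easts⁻ k l e above) off

      decode : ∀ {l} → l ∈ smallCandidates → ∃[ w ] (P w × w ++ [ north ] ≡ word eastsThen l)
      decode l∈
        with (b , e) , l , refl , h∈ , len , ok , (_ , bel) , bal , has ← candidates⁻ l∈
        with here refl , _ ← ∈-cartesianProduct⁻ (false ∷ []) E h∈
        = w , ⇒P (large , subst (All _) (sym (diagonalStarts-eastsThen-easts l e)) (proj₂ (below-eastsThen⁺ k l bel)))
                (↭-trans (eastRuns-eastsThen-easts l e) has)
        , sym (word-eastsThen-∷ false e l)
        where
        w : Path
        w = word eastsThen l ++ easts e
        weight : e + W l ≡ n
        weight = weight-good ((false , e) ∷ l) bal has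
        large : Large k S n w
        large = record
          { ends = trans (endpoint-eastsThen-easts l e) (cong₂ _,_ weight (trans len (*-comm n k)))
          ; above = above-easts⁺ k l e (proj₁ (below-eastsThen⁺ k l bel))
              (≤-reflexive (trans (cong (k *_) weight) (trans (*-comm k n) (sym len))))
          ; diagonals = subst (All _) (sym (diagonalStarts-eastsThen-easts l e))
              (All.map (λ {(x , y)} → startAt⁻ x y) (allowed-eastsThen⁺ startAt l ok))
          }

    -- Large paths: the letter of a level is the step reaching it and the east run on it;
    -- an initial north step completes the bottom letter.

    large↔ : ∀ {P : Path → Set} heads → Unique heads →
      (∀ {w} → P w → Large k S n w × HasType lam w) →
      (∀ {w b e} l → P w → north ∷ w ≡ word thenEasts ((b , e) ∷ l) → e ≤ sum p →
         endAt (length l) ≡ endAt (n * k) → (b , e) ∈ heads) →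
      (∀ {w h} l → h ∈ heads → north ∷ w ≡ word thenEasts (h ∷ l) → Large k S n w → HasType lam w → P w) →
      (∀ {b e} → (b , e) ∈ heads → b ≡ true → endAt (n * k) ≡ true) →
      Refinement Path P ↔ Fin (length (Candidates.candidates endAt heads))
    large↔ {P} heads unique P⇒ ∈heads ⇒P heads-ok =
      refinement↔Fin (λ w l → north ∷ w ≡ word thenEasts l) candidates
      (Unique-candidates unique)
      (λ w l → ≡-dec _≟ˢ_ (north ∷ w) (word thenEasts l))
      (λ eq eq′ → ∷-injectiveʳ (trans eq (sym eq′)))
      (λ eq eq′ → word-injective concatMap-thenEasts-injective (trans (sym eq) eq′))
      encode decode
      where
      open Candidates endAt heads

      encode : ∀ {w} → P w → ∃[ l ] (l ∈ candidates × north ∷ w ≡ word thenEasts l)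
      encode {w} Pw with (b , e) , l , eq ← encode-thenEasts w =
        (b , e) ∷ l ,
        candidates⁺ (b , e) l (∈heads l Pw eq (All.head (runs-bounded ((b , e) ∷ l) has)) (cong endAt len))
          len (proj₂ ok) (bel , balanced ((b , e) ∷ l) weight has , has) ,
        eq
        where
        open Large (proj₁ (P⇒ Pw))
        has : HasRuns ((b , e) ∷ l)
        has = ↭-trans (↭-sym (eastRuns-thenEasts ((b , e) ∷ l)))
          (↭-trans (↭-reflexive (cong eastRuns (sym eq))) (proj₂ (P⇒ Pw)))
        end : (W ((b , e) ∷ l) , suc (length l)) ≡ (n , suc (k * n))
        end = begin
          (W ((b , e) ∷ l) , suc (length l))            ≡⟨ endpoint-thenEasts ((b , e) ∷ l) ⟨
          endpoint origin (word thenEasts ((b , e) ∷ l)) ≡⟨ cong (endpoint origin) eq ⟨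
          endpoint (up origin) w                         ≡⟨ endpoint-up origin w ⟩
          up (endpoint origin w)                         ≡⟨ cong up ends ⟩
          (n , suc (k * n))                              ∎
          where open ≡-Reasoning
        weight : W ((b , e) ∷ l) ≡ n
        weight = cong proj₁ end
        len : length l ≡ n * k
        len = trans (suc-injective (cong proj₂ end)) (*-comm k n)
        ok : Allowed endAt ((b , e) ∷ l)
        ok = allowed-thenEasts⁻ endAt ((b , e) ∷ l) (subst (λ v → All (StartsIn endAt) (diagonalStarts origin v)) eq
          (subst (All _) (sym (diagonalStarts-up origin w)) (All.map⁺ (All.map (λ {(x , y)} → startAt⁺ x y) diagonals))))
        bel : Below k ((b , e) ∷ l)
        bel = below-thenEasts⁻ k ((b , e) ∷ l) (subst (λ v → All (StrictlyAbove k) (visited origin v)) eq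
          (subst (All _) (sym (points-up origin w)) (All.map⁺ (All.map s≤s above))))

      decode : ∀ {l} → l ∈ candidates → ∃[ w ] (P w × north ∷ w ≡ word thenEasts l)
      decode l∈
        with (b , e) , l , refl , h∈ , len , ok , bel , bal , has ← candidates⁻ l∈
        with w , eq ← decode-thenEasts k (b , e) l bel
        = w , ⇒P l h∈ eq large (↭-trans (↭-reflexive (cong eastRuns eq)) (↭-trans (eastRuns-thenEasts ((b , e) ∷ l)) has)) , eq
        where
        end : up (endpoint origin w) ≡ (n , suc (k * n))
        end = begin
          up (endpoint origin w)                         ≡⟨ endpoint-up origin w ⟨
          endpoint (up origin) w                         ≡⟨ cong (endpoint origin) eq ⟩
          endpoint origin (word thenEasts ((b , e) ∷ l)) ≡⟨ endpoint-thenEasts ((b , e) ∷ l) ⟩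
          (W ((b , e) ∷ l) , suc (length l))
            ≡⟨ cong₂ _,_ (weight-good ((b , e) ∷ l) bal has) (cong suc (trans len (*-comm n k))) ⟩
          (n , suc (k * n))                              ∎
          where open ≡-Reasoning
        large : Large k S n w
        large = record
          { ends = cong₂ _,_ (cong proj₁ end) (suc-injective (cong proj₂ end))
          ; above = All.map s≤s⁻¹ (All.map⁻ (subst (All _) (points-up origin w)
              (subst (λ v → All (StrictlyAbove k) (visited origin v)) (sym eq) (below-thenEasts⁺ k ((b , e) ∷ l) bel))))
          ; diagonals = All.map (λ {(x , y)} → startAt⁻ x y) (All.map⁻ (subst (All _) (diagonalStarts-up origin w)
              (subst (λ v → All (StartsIn endAt) (diagonalStarts origin v)) (sym eq)
                (allowed-thenEasts⁺ endAt ((b , e) ∷ l) ((λ b≡ → trans (cong endAt len) (heads-ok h∈ b≡)) , ok)))))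
          }

module Fractions where

  open import Defs using (fromℕ)
  open import Data.Integer.Base as ℤ using ()
  import Data.Integer.Properties as ℤ
  open import Data.Nat.Base as ℕ using (ℕ; suc; NonZero)
  import Data.Nat.Properties as ℕ
  open import Data.Rational.Base using (ℚ; _/_; _+_; _*_; toℚᵘ)
  open import Data.Rational.Properties
  open import Data.Rational.Solver using (module +-*-Solver)
  open import Data.Rational.Unnormalised.Base as ℚᵘ using (mkℚᵘ; *≡*)
  import Data.Rational.Unnormalised.Properties as ℚᵘ
  open import Relation.Binary.PropositionalEquality

  fromℕ-+ : ∀ a b → fromℕ (a ℕ.+ b) ≡ fromℕ a + fromℕ b
  fromℕ-+ a b = toℚᵘ-injective (begin
    toℚᵘ (fromℕ (a ℕ.+ b))                ≈⟨ toℚᵘ-fromℚᵘ (mkℚᵘ (ℤ.+ (a ℕ.+ b)) 0) ⟩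
    mkℚᵘ (ℤ.+ (a ℕ.+ b)) 0                ≈⟨ *≡* (cong (ℤ._* ℤ.+ 1) (cong₂ ℤ._+_ (sym (ℤ.*-identityʳ (ℤ.+ a))) (sym (ℤ.*-identityʳ (ℤ.+ b))))) ⟩
    mkℚᵘ (ℤ.+ a) 0 ℚᵘ.+ mkℚᵘ (ℤ.+ b) 0    ≈⟨ ℚᵘ.+-cong (toℚᵘ-fromℚᵘ (mkℚᵘ (ℤ.+ a) 0)) (toℚᵘ-fromℚᵘ (mkℚᵘ (ℤ.+ b) 0)) ⟨
    toℚᵘ (fromℕ a) ℚᵘ.+ toℚᵘ (fromℕ b)    ≈⟨ toℚᵘ-homo-+ (fromℕ a) (fromℕ b) ⟨
    toℚᵘ (fromℕ a + fromℕ b)              ∎)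
    where open import Relation.Binary.Reasoning.Setoid ℚᵘ.≃-setoid

  fromℕ-* : ∀ a b → fromℕ (a ℕ.* b) ≡ fromℕ a * fromℕ b
  fromℕ-* a b = toℚᵘ-injective (begin
    toℚᵘ (fromℕ (a ℕ.* b))                ≈⟨ toℚᵘ-fromℚᵘ (mkℚᵘ (ℤ.+ (a ℕ.* b)) 0) ⟩
    mkℚᵘ (ℤ.+ (a ℕ.* b)) 0                ≈⟨ *≡* (cong (ℤ._* ℤ.+ 1) (ℤ.pos-* a b)) ⟩
    mkℚᵘ (ℤ.+ a) 0 ℚᵘ.* mkℚᵘ (ℤ.+ b) 0    ≈⟨ ℚᵘ.*-cong (toℚᵘ-fromℚᵘ (mkℚᵘ (ℤ.+ a) 0)) (toℚᵘ-fromℚᵘ (mkℚᵘ (ℤ.+ b) 0)) ⟨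
    toℚᵘ (fromℕ a) ℚᵘ.* toℚᵘ (fromℕ b)    ≈⟨ toℚᵘ-homo-* (fromℕ a) (fromℕ b) ⟨
    toℚᵘ (fromℕ a * fromℕ b)              ∎)
    where open import Relation.Binary.Reasoning.Setoid ℚᵘ.≃-setoid

  fromℕ-*-/ : ∀ a b .{{_ : NonZero b}} → fromℕ b * (ℤ.+ a / b) ≡ fromℕ a
  fromℕ-*-/ a b@(suc b-1) = toℚᵘ-injective (begin
    toℚᵘ (fromℕ b * (ℤ.+ a / b))              ≈⟨ toℚᵘ-homo-* (fromℕ b) (ℤ.+ a / b) ⟩
    toℚᵘ (fromℕ b) ℚᵘ.* toℚᵘ (ℤ.+ a / b)      ≈⟨ ℚᵘ.*-cong (toℚᵘ-fromℚᵘ (mkℚᵘ (ℤ.+ b) 0)) (toℚᵘ-fromℚᵘ (mkℚᵘ (ℤ.+ a) b-1)) ⟩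
    mkℚᵘ (ℤ.+ b) 0 ℚᵘ.* mkℚᵘ (ℤ.+ a) b-1      ≈⟨ *≡* cross ⟩
    mkℚᵘ (ℤ.+ a) 0                            ≈⟨ toℚᵘ-fromℚᵘ (mkℚᵘ (ℤ.+ a) 0) ⟨
    toℚᵘ (fromℕ a)                            ∎)
    where
    open import Relation.Binary.Reasoning.Setoid ℚᵘ.≃-setoid
    cross : ℤ.+ b ℤ.* ℤ.+ a ℤ.* ℤ.+ 1 ≡ ℤ.+ a ℤ.* ℤ.+ (1 ℕ.* b)
    cross = trans (ℤ.*-identityʳ (ℤ.+ b ℤ.* ℤ.+ a)) (trans (ℤ.*-comm (ℤ.+ b) (ℤ.+ a))
      (cong (λ z → ℤ.+ a ℤ.* ℤ.+ z) (sym (ℕ.*-identityˡ b))))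

  fromℕ-cancelˡ : ∀ m .{{_ : NonZero m}} {x y} → fromℕ m * x ≡ fromℕ m * y → x ≡ y
  fromℕ-cancelˡ m {x} {y} eq = trans (sym (expand x)) (trans (cong ((ℤ.+ 1 / m) *_) eq) (expand y))
    where
    expand : ∀ z → (ℤ.+ 1 / m) * (fromℕ m * z) ≡ z
    expand z = trans (sym (*-assoc (ℤ.+ 1 / m) (fromℕ m) z))
      (trans (cong (_* z) (trans (*-comm (ℤ.+ 1 / m) (fromℕ m)) (fromℕ-*-/ 1 m))) (*-identityˡ z))

  module _ (s n N A F : ℕ) .{{_ : NonZero s}} .{{_ : NonZero n}} where

    open ≡-Reasoning
    open +-*-Solver

    fraction-diagonal : ∀ D → s ℕ.* (n ℕ.* N) ≡ D ℕ.* (A ℕ.* F) →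
      fromℕ N ≡ (ℤ.+ 1 / n) * fromℕ D * fromℕ A * (ℤ.+ F / s)
    fraction-diagonal D eq = fromℕ-cancelˡ n (fromℕ-cancelˡ s (begin
      fromℕ s * (fromℕ n * fromℕ N)         ≡⟨ trans (fromℕ-* s _) (cong (fromℕ s *_) (fromℕ-* n N)) ⟨
      fromℕ (s ℕ.* (n ℕ.* N))               ≡⟨ cong fromℕ eq ⟩
      fromℕ (D ℕ.* (A ℕ.* F))               ≡⟨ trans (fromℕ-* D _) (cong (fromℕ D *_) (fromℕ-* A F)) ⟩
      fromℕ D * (fromℕ A * fromℕ F)         ≡⟨ trans (cong (_* (fromℕ D * (fromℕ A * fromℕ F))) (fromℕ-*-/ 1 n)) (*-identityˡ _) ⟨
      fromℕ n * x * (fromℕ D * (fromℕ A * fromℕ F))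
        ≡⟨ cong (λ f → fromℕ n * x * (fromℕ D * (fromℕ A * f))) (fromℕ-*-/ F s) ⟨
      fromℕ n * x * (fromℕ D * (fromℕ A * (fromℕ s * z)))
        ≡⟨ solve 6 (λ s n x d a z → n :* x :* (d :* (a :* (s :* z))) := s :* (n :* (x :* d :* a :* z)))
             refl (fromℕ s) (fromℕ n) x (fromℕ D) (fromℕ A) z ⟩
      fromℕ s * (fromℕ n * (x * fromℕ D * fromℕ A * z)) ∎))
      where
      x z : ℚ
      x = ℤ.+ 1 / n
      z = ℤ.+ F / s

    module _ (m c : ℕ) .{{_ : NonZero m}} where

      fraction-all : ∀ D D′ → s ℕ.* m ℕ.* (n ℕ.* N) ≡ (m ℕ.* D ℕ.+ c ℕ.* D′) ℕ.* (A ℕ.* F) →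
        fromℕ N ≡ (ℤ.+ 1 / n) * (fromℕ D + (ℤ.+ c / m) * fromℕ D′) * fromℕ A * (ℤ.+ F / s)
      fraction-all D D′ eq = fromℕ-cancelˡ n (fromℕ-cancelˡ m (fromℕ-cancelˡ s (begin
        fromℕ s * (fromℕ m * (fromℕ n * fromℕ N))
          ≡⟨ trans (fromℕ-* s _) (cong (fromℕ s *_) (trans (fromℕ-* m _) (cong (fromℕ m *_) (fromℕ-* n N)))) ⟨
        fromℕ (s ℕ.* (m ℕ.* (n ℕ.* N)))
          ≡⟨ cong fromℕ (trans (sym (ℕ.*-assoc s m _)) eq) ⟩
        fromℕ ((m ℕ.* D ℕ.+ c ℕ.* D′) ℕ.* (A ℕ.* F))
          ≡⟨ trans (fromℕ-* (m ℕ.* D ℕ.+ c ℕ.* D′) _) (cong₂ _*_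
               (trans (fromℕ-+ (m ℕ.* D) _) (cong₂ _+_ (fromℕ-* m D) (fromℕ-* c D′))) (fromℕ-* A F)) ⟩
        (fromℕ m * fromℕ D + fromℕ c * fromℕ D′) * (fromℕ A * fromℕ F)
          ≡⟨ trans (cong (_* ((fromℕ m * fromℕ D + fromℕ c * fromℕ D′) * (fromℕ A * fromℕ F))) (fromℕ-*-/ 1 n)) (*-identityˡ _) ⟨
        fromℕ n * x * ((fromℕ m * fromℕ D + fromℕ c * fromℕ D′) * (fromℕ A * fromℕ F))
          ≡⟨ cong₂ (λ g f → fromℕ n * x * ((fromℕ m * fromℕ D + g * fromℕ D′) * (fromℕ A * f)))
               (fromℕ-*-/ c m) (fromℕ-*-/ F s) ⟨
        fromℕ n * x * ((fromℕ m * fromℕ D + fromℕ m * y * fromℕ D′) * (fromℕ A * (fromℕ s * z)))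
          ≡⟨ solve 9 (λ s m n x y d d′ a z → n :* x :* ((m :* d :+ m :* y :* d′) :* (a :* (s :* z)))
                        := s :* (m :* (n :* (x :* (d :+ y :* d′) :* a :* z))))
               refl (fromℕ s) (fromℕ m) (fromℕ n) x y (fromℕ D) (fromℕ D′) (fromℕ A) z ⟩
        fromℕ s * (fromℕ m * (fromℕ n * (x * (fromℕ D + y * fromℕ D′) * fromℕ A * z))) ∎)))
        where
        x y z : ℚ
        x = ℤ.+ 1 / n
        y = ℤ.+ c / m
        z = ℤ.+ F / s

      fraction-north : ∀ D → s ℕ.* m ℕ.* (n ℕ.* N) ≡ c ℕ.* (D ℕ.* (A ℕ.* F)) →
        fromℕ N ≡ (ℤ.+ 1 / n) * (ℤ.+ c / m) * fromℕ D * fromℕ A * (ℤ.+ F / s)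
      fraction-north D eq = trans
        (fraction-all 0 D (trans eq (trans (sym (ℕ.*-assoc c D _))
          (cong (λ z → (z ℕ.+ c ℕ.* D) ℕ.* (A ℕ.* F)) (sym (ℕ.*-zeroʳ m))))))
        (cong (λ q → q * fromℕ A * (ℤ.+ F / s))
          (trans (cong ((ℤ.+ 1 / n) *_) (+-identityˡ ((ℤ.+ c / m) * fromℕ D)))
            (sym (*-assoc (ℤ.+ 1 / n) (ℤ.+ c / m) (fromℕ D)))))

open import Defs
open import Data.Fin.Subset using (Subset; ∣_∣)
open import Data.Integer.Base using (+_; _-_)
open import Data.Nat.Base as ℕ using (ℕ; NonZero)
open import Data.Product.Base using (_×_)
open import Data.Rational.Base using (ℚ; _/_; _+_; _*_)
open import Relation.Nullary using (¬_)

open import Data.Bool.Base using (true)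
open import Data.List.Base using (List; []; _∷_; length; last)
open import Data.List.Membership.Propositional.Properties using (∈-cartesianProduct⁺; ∈-upTo⁺)
open import Data.List.Relation.Unary.All as All using ([])
open import Data.List.Relation.Unary.AllPairs using ([]; _∷_)
open import Data.List.Relation.Unary.Any using (here)
import Data.List.Relation.Unary.Unique.Propositional.Properties as Unique
import Data.Nat.Properties as ℕ
open import Data.Product.Base using (_,_; proj₂)
open import Relation.Binary.PropositionalEquality using (_≡_; refl; sym; trans; cong; subst)

open PathCounting
open Fractions

module Counts (k n : ℕ) .{{_ : NonZero k}} .{{_ : NonZero n}} (S : Subset k) (lam : Partition) where

  open Encoding k n S lam

  s : ℕ
  s = multFactorial lam

  instance
    s≢0 : NonZero s
    s≢0 = multFactorial≢0 lam

  common-count : ∀ {P : Path → Set} →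
    (∀ {w} → P w → Large k S n w × HasType lam w × All.All (EndsOff k) (diagonalStarts origin w)) →
    (∀ {w} → Small k S n w → HasType lam w → P w) →
    NumberOfPaths P ((+ 1 / n) * (+ size lam / ℕ.suc (k ℕ.* n))
               * fromℕ (binom (∣ S ∣ ℕ.* n) (+ n - + size lam))
               * fromℕ (binom (ℕ.suc (k ℕ.* n)) (+ ℓ lam))
               * arrangements lam)
  common-count P⇒ ⇒P = length smallCandidates , small↔ P⇒ ⇒P ,
    fraction-north s n (length smallCandidates) (binom (ℕ.suc (k ℕ.* n)) (+ ℓ lam)) (ℓ lam ℕ.!)
      (ℕ.suc (k ℕ.* n)) (size lam) (binom (∣ S ∣ ℕ.* n) (+ n - + size lam)) counted
    where
    open Periodic startAt startAt-periodic
    counted : s ℕ.* ℕ.suc (k ℕ.* n) ℕ.* (n ℕ.* length smallCandidates) ≡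
      size lam ℕ.* (binom (∣ S ∣ ℕ.* n) (+ n - + size lam) ℕ.* falling (ℕ.suc (k ℕ.* n)) (ℓ lam))
    counted rewrite Candidates.length-candidates startAt northHeads | ℕ.*-comm k n | sym (∑-startAt n) =
      goodCount-north inRange

  module _ (k∈S : k ∈₁ S) where

    open Periodic endAt endAt-periodic

    diagonalHead : List Letter
    diagonalHead = (true , 0) ∷ []

    diagonal-count : NumberOfPaths (λ w → Large k S n w × HasType lam w × EndsInDiagonal w)
      ((+ 1 / n)
        * fromℕ (binom (∣ S ∣ ℕ.* n) (+ n - + 1 - + size lam))
        * fromℕ (binom (k ℕ.* n) (+ ℓ lam))
        * arrangements lam)
    diagonal-count = N , large↔ diagonalHead (All.[] ∷ [])
        (λ (large , type , _) → large , type)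
        (λ {w} {b} {e} l (_ , _ , ends) eq _ _ → here (last-thenEasts⁻ b e (trans (sym (last-letter l)) (subst EndsInDiagonal eq (last-north⁺ w ends)))))
        (λ { {w} l (here refl) eq large type → large , type ,
             last-north⁻ w (subst EndsInDiagonal (sym eq) (last-letter l)) })
        (λ _ _ → endAt-multiple k∈S n) ,
      fraction-diagonal s n N (binom (k ℕ.* n) (+ ℓ lam)) (ℓ lam ℕ.!) (binom (∣ S ∣ ℕ.* n) (+ n - + 1 - + size lam)) counted
      where
      N : ℕ
      N = length (Candidates.candidates endAt diagonalHead)
      last-letter : ∀ {b e} l → last (word thenEasts ((b , e) ∷ l)) ≡ last (step b ∷ easts e)
      last-letter {b} {e} l = trans (cong last (word-∷ thenEasts (b , e) l)) (last-++-∷ (word thenEasts l) (step b) (easts e))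
      counted : s ℕ.* (n ℕ.* N) ≡ binom (∣ S ∣ ℕ.* n) (+ n - + 1 - + size lam) ℕ.* falling (k ℕ.* n) (ℓ lam)
      counted rewrite Candidates.length-candidates endAt diagonalHead | ℕ.*-comm k n | sym (∑-endAt k∈S n) =
        goodCount-diagonal inRange

    all-count : NumberOfPaths (λ w → Large k S n w × HasType lam w)
      ((+ 1 / n)
        * (fromℕ (binom (∣ S ∣ ℕ.* n) (+ n - + 1 - + size lam))
           + (+ size lam / ℕ.suc (k ℕ.* n)) * fromℕ (binom (∣ S ∣ ℕ.* n ℕ.+ 1) (+ n - + size lam)))
        * fromℕ (binom (ℕ.suc (k ℕ.* n)) (+ ℓ lam))
        * arrangements lam)
    all-count = N , large↔ (letters true) (Unique.cartesianProduct⁺ (Unique-steps true) (Unique.upTo⁺ (ℕ.suc (size lam))))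
        (λ lt → lt)
        (λ l _ _ e≤ _ → ∈-cartesianProduct⁺ (∈-steps⁺ true (λ _ → refl)) (∈-upTo⁺ (ℕ.s≤s e≤)))
        (λ _ _ _ large type → large , type)
        (λ _ _ → endAt-multiple k∈S n) ,
      fraction-all s n N (binom (ℕ.suc (k ℕ.* n)) (+ ℓ lam)) (ℓ lam ℕ.!) (ℕ.suc (k ℕ.* n)) (size lam)
        (binom (∣ S ∣ ℕ.* n) (+ n - + 1 - + size lam)) (binom (∣ S ∣ ℕ.* n ℕ.+ 1) (+ n - + size lam)) counted
      where
      N : ℕ
      N = length (Candidates.candidates endAt (letters true))
      counted : s ℕ.* ℕ.suc (k ℕ.* n) ℕ.* (n ℕ.* N) ≡
        (ℕ.suc (k ℕ.* n) ℕ.* binom (∣ S ∣ ℕ.* n) (+ n - + 1 - + size lam)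
          ℕ.+ size lam ℕ.* binom (∣ S ∣ ℕ.* n ℕ.+ 1) (+ n - + size lam)) ℕ.* falling (ℕ.suc (k ℕ.* n)) (ℓ lam)
      counted rewrite Candidates.length-candidates endAt (letters true) | ℕ.*-comm k n | ℕ.+-comm (∣ S ∣ ℕ.* n) 1 | sym (∑-endAt k∈S n) =
        goodCount-all inRange

mainTheorem4 :
    (k n : ℕ) .{{_ : NonZero k}} .{{_ : NonZero n}} (S : Subset k) (lam : Partition) →
    let d : ℕ
        d = ∣ S ∣
        kn+1 : ℕ
        kn+1 = ℕ.suc (k ℕ.* n)
        common : ℚ
        common = (+ 1 / n) * (+ size lam / kn+1)
               * fromℕ (binom (d ℕ.* n) (+ n - + size lam))
               * fromℕ (binom kn+1 (+ ℓ lam))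
               * arrangements lam
    in
      (¬ (k ∈₁ S) →
        NumberOfPaths (λ w → Large k S n w × HasType lam w) common)
      ×
      (k ∈₁ S →
        NumberOfPaths (λ w → Small k S n w × HasType lam w) common
        ×
        NumberOfPaths (λ w → Large k S n w × HasType lam w × EndsInDiagonal w)
          ((+ 1 / n)
            * fromℕ (binom (d ℕ.* n) (+ n - + 1 - + size lam))
            * fromℕ (binom (k ℕ.* n) (+ ℓ lam))
            * arrangements lam)
        ×
        NumberOfPaths (λ w → Large k S n w × HasType lam w)
          ((+ 1 / n)
            * (fromℕ (binom (d ℕ.* n) (+ n - + 1 - + size lam))
               + (+ size lam / kn+1) * fromℕ (binom (d ℕ.* n ℕ.+ 1) (+ n - + size lam)))
            * fromℕ (binom kn+1 (+ ℓ lam))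
            * arrangements lam))
mainTheorem4 k n S lam =
  (λ k∉S → common-count
    (λ (large , type) → large , type ,
      All.map (λ {q} ok on → k∉S (Residues.endsOnLine⇒k∈S k S q ok on)) (Large.diagonals large))
    (λ (large , _) type → large , type)) ,
  (λ k∈S → common-count
      (λ ((large , off) , type) → large , type , All.map proj₂ off)
      (λ small type → small , type) ,
    diagonal-count k∈S ,
    all-count k∈S)
  where open Counts k n S lam
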